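{- (Exact Pair Theorem) Let $(A_i)_{i\in\omega}$ be a uniformly c.e. sequence of ceers. Then there exist ceers $X$ and $Y$ such that $\bigoplus_{i\leq n}A_i\leq X$ and $\bigoplus_{i\leq n}A_i\leq Y$ for every $n$, and such that every ceer $Z$ with $Z\leq X$ and $Z\leq Y$ satisfies $Z\leq\bigoplus_{i\leq n}A_i$ for some $n$. Further, if each $A_i$ is either dark or has only finitely many classes, then $X$ and $Y$ can be chosen to be dark.
   Context: A ceer is a computably enumerable equivalence relation on $\omega$. For equivalence relations $E,R$ on $\omega$, $E\leq R$ means there is a computable $f$ with $x\mathrel{E}y\iff f(x)\mathrel{R}f(y)$ for all $x,y$. A sequence of ceers $(A_i)$ is uniformly c.e. if $\{(i,x,y)\mid x\mathrel{A_i}y\}$ is c.e. For $m\geq1$ the finite uniform join $\bigoplus_{i<m}A_i$ is the equivalence relation in which $x,y$ are equivalent iff there is $i<m$ with $x\equiv y\equiv i\pmod m$ and $\frac{x-i}{m}\mathrel{A_i}\frac{y-i}{m}$; $\bigoplus_{i\leq n}A_i$ means $\bigoplus_{i<n+1}A_i$. $\mathrm{Id}$ is equality on $\omega$. A ceer $R$ is dark if it has infinitely many classes and $\mathrm{Id}\not\leq R$. -}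

module Defs where

open import Level using (0ℓ)
open import Data.Nat using (ℕ; zero; suc; _<_; _∸_; _≤_)
open import Data.Nat.DivMod using (_/_; _%_)
open import Data.Fin using (Fin)
open import Data.Vec using (Vec; []; _∷_; lookup)
open import Data.Product using (Σ; _×_; ∃)
open import Data.Sum using (_⊎_)
open import Relation.Nullary using (¬_)
open import Relation.Binary.PropositionalEquality using (_≡_)
open import Relation.Binary.Structures using (IsEquivalence)
open import Function.Bundles using (_⇔_)

data PR : ℕ → Set where
  zeroF : ∀ {n} → PR n
  succF : PR 1
  proj  : ∀ {n} → Fin n → PR n
  comp  : ∀ {m n} → PR m → Vec (PR n) m → PR n
  prim  : ∀ {n} → PR n → PR (suc (suc n)) → PR (suc n)
  mu    : ∀ {n} → PR (suc n) → PR n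

mutual
  data Eval : ∀ {n} → PR n → Vec ℕ n → ℕ → Set where
    ev-zero : ∀ {n} {xs : Vec ℕ n} → Eval zeroF xs 0
    ev-succ : ∀ {x} → Eval succF (x ∷ []) (suc x)
    ev-proj : ∀ {n} {i : Fin n} {xs} → Eval (proj i) xs (lookup xs i)
    ev-comp : ∀ {m n} {f : PR m} {gs : Vec (PR n) m} {xs ys z} →
              EvalVec gs xs ys → Eval f ys z → Eval (comp f gs) xs z
    ev-prim0 : ∀ {n} {f : PR n} {g} {xs z} →
               Eval f xs z → Eval (prim f g) (0 ∷ xs) z
    ev-primS : ∀ {n} {f : PR n} {g} {k xs z w} →
               Eval (prim f g) (k ∷ xs) z → Eval g (k ∷ z ∷ xs) w →
               Eval (prim f g) (suc k ∷ xs) w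
    ev-mu : ∀ {n} {f : PR (suc n)} {xs y} →
            Eval f (y ∷ xs) 0 →
            (∀ z → z < y → Σ ℕ (λ v → Eval f (z ∷ xs) (suc v))) →
            Eval (mu f) xs y

  data EvalVec : ∀ {m n} → Vec (PR n) m → Vec ℕ n → Vec ℕ m → Set where
    evv-nil  : ∀ {n} {xs : Vec ℕ n} → EvalVec [] xs []
    evv-cons : ∀ {m n} {g : PR n} {gs : Vec (PR n) m} {xs y ys} →
               Eval g xs y → EvalVec gs xs ys → EvalVec (g ∷ gs) xs (y ∷ ys)

Computable : (ℕ → ℕ) → Set
Computable f = Σ (PR 1) (λ c → ∀ x → Eval c (x ∷ []) (f x))

BinRel : Set₁
BinRel = ℕ → ℕ → Set

CE : BinRel → Set
CE R = Σ (PR 2) (λ c → ∀ x y → R x y ⇔ ∃ (λ v → Eval c (x ∷ y ∷ []) v))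

UniformlyCE : (ℕ → BinRel) → Set
UniformlyCE A = Σ (PR 3) (λ c → ∀ i x y → A i x y ⇔ ∃ (λ v → Eval c (i ∷ x ∷ y ∷ []) v))

IsCeer : BinRel → Set
IsCeer R = IsEquivalence R × CE R

_≤ᶜ_ : BinRel → BinRel → Set
E ≤ᶜ R = Σ (ℕ → ℕ) (λ f → Computable f × (∀ x y → E x y ⇔ R (f x) (f y)))

JoinLe : (ℕ → BinRel) → ℕ → BinRel
JoinLe A n x y = Σ ℕ (λ i → i ≤ n × x % suc n ≡ i × y % suc n ≡ i ×
                   A i ((x ∸ i) / suc n) ((y ∸ i) / suc n))

IdRel : BinRel
IdRel = _≡_

FinitelyManyClasses : BinRel → Set
FinitelyManyClasses R = Σ ℕ (λ k → Σ (Fin k → ℕ) (λ g → ∀ x → ∃ (λ j → R x (g j))))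

Dark : BinRel → Set
Dark R = ¬ FinitelyManyClasses R × ¬ (IdRel ≤ᶜ R)

ExactPair : (ℕ → BinRel) → BinRel → BinRel → Set₁
ExactPair A X Y =
  IsCeer X × IsCeer Y ×
  (∀ n → JoinLe A n ≤ᶜ X) × (∀ n → JoinLe A n ≤ᶜ Y) ×
  (∀ (Z : BinRel) → IsCeer Z → Z ≤ᶜ X → Z ≤ᶜ Y → ∃ (λ n → Z ≤ᶜ JoinLe A n))

module Submission where

-- One computable construction, which does not look at the A_i, labels the natural numbers on
-- countably many sides. A label (i , c) stands for the element c of A_i, and labels only
-- change by moving to a smaller column i, so every number has a limit label. X a is the
-- pullback along the limit labels of side a of the union of the A_i; it is c.e. because
-- relabelling treats all numbers of one column of a side alike.
--
-- Requirement k, for programs f and g and sides a ≠ b, may move the labels in columns above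
-- k + 1 into columns up to k + 1. It waits for arguments x , y such that f x has such a free
-- label, g x or g y has one, and the columns of f x , f y or those of g x , g y differ. Then
-- it can separate one of the two pairs for good while merging the other one, so that f and g
-- do not reduce the same relation to X a and X b. If it waits forever, all limit labels of
-- f, or all of g, lie in finitely many columns, and reading them off gives a reduction to
-- a finite join. A priority argument makes every requirement act finitely often, so fresh
-- numbers code the columns up to n without being disturbed.
--
-- Any two of the X a thus form an exact pair. If Id reduced to two of them it would reduce
-- to a finite join, hence to some A_i, which is impossible when the A_i are dark or finite.
-- So two of X 0, X 1, X 2 are dark.

open import Defs
open import Level using (0ℓ)
open import Data.Bool using (Bool; true; false; if_then_else_; not; _∧_; _∨_) renaming (T to BT)
open import Data.Empty using (⊥)
open import Data.Fin using (Fin; zero; suc; toℕ)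
open import Data.Fin.Properties using (pigeonhole; toℕ<n)
open import Data.List using (List; []; _∷_; _++_; length; foldl; foldr)
open import Data.List.Properties using (++-identityʳ; reverse-foldl)
open import Data.Nat
  using (ℕ; zero; suc; pred; _+_; _*_; _∸_; _≤_; _<_; z≤n; s≤s; _≡ᵇ_; _<ᵇ_; _⊔_; _≤?_; _<?_; _≟_; _≤′_; ≤′-refl; ≤′-step)
open import Data.Nat.Divisibility using (n∣m*n)
open import Data.Nat.DivMod
open import Data.Nat.Induction using (<-rec)
open import Data.Nat.Properties hiding (_≤?_; _<?_; _≟_)
open import Data.Product using (Σ; _×_; ∃-syntax; _,_; proj₁; proj₂)
open import Data.Sum using (_⊎_; inj₁; inj₂; [_,_]′)
open import Data.Unit using (⊤; tt)
open import Data.Vec using (Vec; []; _∷_; lookup; tabulate; toList)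
open import Data.Vec.Properties using (tabulate∘lookup)
open import Function.Base using (_∘_)
open import Function.Bundles using (_⇔_; mk⇔; Equivalence)
open import Relation.Binary using (tri<; tri≈; tri>)
open import Relation.Binary.PropositionalEquality
open import Relation.Binary.Structures using (IsEquivalence)
open import Relation.Nullary using (¬_; Dec; yes; no; contradiction)
open import Axiom.ExcludedMiddle using (ExcludedMiddle)

-- Computable functions on coded data

mutual
  eval-det : ∀ {n} {c : PR n} {xs v w} → Eval c xs v → Eval c xs w → v ≡ w
  eval-det ev-zero ev-zero = refl
  eval-det ev-succ ev-succ = refl
  eval-det ev-proj ev-proj = refl
  eval-det (ev-comp p q) (ev-comp p′ q′) with evalVec-det p p′
  ... | refl = eval-det q q′
  eval-det (ev-prim0 p) (ev-prim0 p′) = eval-det p p′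
  eval-det (ev-primS p q) (ev-primS p′ q′) with eval-det p p′
  ... | refl = eval-det q q′
  eval-det (ev-mu {y = y} p h) (ev-mu {y = y′} p′ h′) with <-cmp y y′
  ... | tri≈ _ eq _ = eq
  ... | tri< lt _ _ = contradiction (eval-det p (proj₂ (h′ y lt))) λ ()
  ... | tri> _ _ gt = contradiction (eval-det (proj₂ (h y′ gt)) p′) λ ()

  evalVec-det : ∀ {m n} {cs : Vec (PR n) m} {xs ys zs} → EvalVec cs xs ys → EvalVec cs xs zs → ys ≡ zs
  evalVec-det evv-nil evv-nil = refl
  evalVec-det (evv-cons p ps) (evv-cons q qs) = cong₂ _∷_ (eval-det p q) (evalVec-det ps qs)

-- Numbers as codes of pairs and trees

tri : ℕ → ℕ
tri zero = 0
tri (suc n) = suc (n + tri n)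

root : ℕ → ℕ
root zero = 0
root (suc n) = if suc n ≡ᵇ tri (suc (root n)) then suc (root n) else root n

≡ᵇ-true : ∀ m n → (m ≡ᵇ n) ≡ true → m ≡ n
≡ᵇ-true zero zero _ = refl
≡ᵇ-true (suc m) (suc n) p = cong suc (≡ᵇ-true m n p)

≡ᵇ-refl : ∀ n → (n ≡ᵇ n) ≡ true
≡ᵇ-refl zero = refl
≡ᵇ-refl (suc n) = ≡ᵇ-refl n

≢⇒≡ᵇ : ∀ m n → m ≢ n → (m ≡ᵇ n) ≡ false
≢⇒≡ᵇ m n m≢n with m ≡ᵇ n in eq
... | true = contradiction (≡ᵇ-true m n eq) m≢n
... | false = refl

-- `root` grows only on reaching the next triangular number, and `tri (suc m)` lies `m + 1` places
-- after `tri m`.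
root-tri : ∀ m j → j ≤ m → root (j + tri m) ≡ m
root-tri zero zero _ = refl
root-tri (suc m) zero _
  rewrite root-tri m m ≤-refl | ≡ᵇ-refl (m + tri m) = refl
root-tri m (suc j) j<m
  rewrite root-tri m j (<⇒≤ j<m)
        | ≢⇒≡ᵇ (j + tri m) (m + tri m) (λ e → <⇒≢ j<m (+-cancelʳ-≡ (tri m) j m e)) = refl

n≤tri : ∀ n → n ≤ tri n
n≤tri zero = z≤n
n≤tri (suc n) = s≤s (m≤m+n n (tri n))

opaque
  -- Cantor's pairing: the diagonal of sum `a + b` starts at `tri (a + b)`, so `root` recovers the
  -- sum and what remains is `a`.
  pair : ℕ → ℕ → ℕ
  pair a b = a + tri (a + b)

  π₁ π₂ : ℕ → ℕ
  π₁ n = n ∸ tri (root n)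
  π₂ n = root n ∸ π₁ n

  pair-def : ∀ a b → pair a b ≡ a + tri (a + b)
  pair-def a b = refl

  π₁-def : ∀ n → π₁ n ≡ n ∸ tri (root n)
  π₁-def n = refl

  π₂-def : ∀ n → π₂ n ≡ root n ∸ π₁ n
  π₂-def n = refl

  pair-00 : pair 0 0 ≡ 0
  pair-00 = refl

  π₁-0 : π₁ 0 ≡ 0
  π₁-0 = refl

  π₂-0 : π₂ 0 ≡ 0
  π₂-0 = refl

  π₁-pair : ∀ a b → π₁ (pair a b) ≡ a
  π₁-pair a b rewrite root-tri (a + b) a (m≤m+n a b) = m+n∸n≡m a (tri (a + b))

  π₂-pair : ∀ a b → π₂ (pair a b) ≡ b
  π₂-pair a b rewrite π₁-pair a b | root-tri (a + b) a (m≤m+n a b) = m+n∸m≡n a b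

  -- Induction walks along the diagonals: one place forward, or from the end of a diagonal to the
  -- start of the next.
  pair-surjective : ∀ n → ∃[ a ] ∃[ b ] pair a b ≡ n
  pair-surjective zero = 0 , 0 , refl
  pair-surjective (suc n) with pair-surjective n
  ... | a , suc b , eq = suc a , b , cong suc (trans (cong (λ m → a + tri m) (sym (+-suc a b))) eq)
  ... | a , zero , eq = 0 , suc a , cong suc (trans (cong (λ m → a + tri m) (sym (+-identityʳ a))) eq)

  pair≥₁ : ∀ a b → a ≤ pair a b
  pair≥₁ a b = m≤m+n a _

  pair≥₂ : ∀ a b → b ≤ pair a b
  pair≥₂ a b = ≤-trans (m≤n+m b a) (≤-trans (n≤tri (a + b)) (m≤n+m _ a))

-- An untyped carrier for programs of every arity. Its coding is a bijection with the numbers, so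
-- every number can serve as a program index.
data Tree : Set where
  leaf : Tree
  node : ℕ → Tree → Tree → Tree

encTree : Tree → ℕ
encTree leaf = 0
encTree (node n l r) = suc (pair n (pair (encTree l) (encTree r)))

encTree-surjective : ∀ n → ∃[ t ] encTree t ≡ n
encTree-surjective = <-rec _ go
  where
  go : ∀ n → (∀ {m} → m < n → ∃[ t ] encTree t ≡ m) → ∃[ t ] encTree t ≡ n
  go zero _ = leaf , refl
  go (suc n) ih with pair-surjective n
  ... | a , q , refl with pair-surjective q
  ... | b , c , refl
    with ih {b} (s≤s (≤-trans (pair≥₁ b c) (pair≥₂ a (pair b c))))
       | ih {c} (s≤s (≤-trans (pair≥₂ b c) (pair≥₂ a (pair b c))))
  ... | l , refl | r , refl = node a l r , refl

opaque
  decTree : ℕ → Tree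
  decTree n = proj₁ (encTree-surjective n)

  enc-decTree : ∀ n → encTree (decTree n) ≡ n
  enc-decTree n = proj₂ (encTree-surjective n)

pair-injective : ∀ a b c d → pair a b ≡ pair c d → a ≡ c × b ≡ d
pair-injective a b c d e =
  trans (sym (π₁-pair a b)) (trans (cong π₁ e) (π₁-pair c d)) ,
  trans (sym (π₂-pair a b)) (trans (cong π₂ e) (π₂-pair c d))

encTree-injective : ∀ s t → encTree s ≡ encTree t → s ≡ t
encTree-injective leaf leaf _ = refl
encTree-injective (node n l r) (node m l′ r′) e with pair-injective n _ m _ (suc-injective e)
... | refl , e′ with pair-injective _ _ _ _ e′
... | e₁ , e₂ = cong₂ (node n) (encTree-injective l l′ e₁) (encTree-injective r r′ e₂)

dec-encTree : ∀ t → decTree (encTree t) ≡ t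
dec-encTree t = encTree-injective _ t (enc-decTree (encTree t))

-- Typed terms that carry their programs

infixr 5 _⊗_

data Ty : Set where
  N B T : Ty
  _⊗_ : Ty → Ty → Ty
  L : Ty → Ty

⟦_⟧ : Ty → Set
⟦ N ⟧ = ℕ
⟦ B ⟧ = Bool
⟦ T ⟧ = Tree
⟦ A ⊗ A′ ⟧ = ⟦ A ⟧ × ⟦ A′ ⟧
⟦ L A ⟧ = List ⟦ A ⟧

encList : ∀ {A : Set} → (A → ℕ) → List A → ℕ
encList f [] = 0
encList f (a ∷ l) = suc (pair (f a) (encList f l))

-- true is coded by 0, so that the mu operator looks for truth.
enc : ∀ A → ⟦ A ⟧ → ℕ
enc N n = n
enc B true = 0
enc B false = 1
enc T t = encTree t
enc (A ⊗ A′) (a , a′) = pair (enc A a) (enc A′ a′)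
enc (L A) l = encList (enc A) l

-- Every type has a value coded by 0, so the total hd, tl, left and right agree with
-- truncated decoding on empty structures.
default : ∀ A → ⟦ A ⟧
default N = 0
default B = true
default T = leaf
default (A ⊗ A′) = default A , default A′
default (L A) = []

enc-default : ∀ A → enc A (default A) ≡ 0
enc-default N = refl
enc-default B = refl
enc-default T = refl
enc-default (A ⊗ A′) = trans (cong₂ pair (enc-default A) (enc-default A′)) pair-00
enc-default (L A) = refl

Env : List Ty → Set
Env [] = ⊤
Env (A ∷ Γ) = ⟦ A ⟧ × Env Γ

encEnv : ∀ Γ → Env Γ → Vec ℕ (length Γ)
encEnv [] _ = []
encEnv (A ∷ Γ) (a , ρ) = enc A a ∷ encEnv Γ ρ

infix 4 _∋_

data _∋_ : List Ty → Ty → Set where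
  here : ∀ {Γ A} → A ∷ Γ ∋ A
  there : ∀ {Γ A A′} → Γ ∋ A → A′ ∷ Γ ∋ A

idx : ∀ {Γ A} → Γ ∋ A → Fin (length Γ)
idx here = zero
idx (there x) = suc (idx x)

get : ∀ {Γ A} → Γ ∋ A → Env Γ → ⟦ A ⟧
get here (a , _) = a
get (there x) (_ , ρ) = get x ρ

lookup-encEnv : ∀ {Γ A} (x : Γ ∋ A) ρ → lookup (encEnv Γ ρ) (idx x) ≡ enc A (get x ρ)
lookup-encEnv here _ = refl
lookup-encEnv (there x) (_ , ρ) = lookup-encEnv x ρ

-- The combinators below build a function and its program together, so writing a function as a term
-- already proves it computable.
record Tm (Γ : List Ty) (A : Ty) : Set where
  constructor tm
  field
    fun : Env Γ → ⟦ A ⟧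
    code : PR (length Γ)
    ok : ∀ ρ → Eval code (encEnv Γ ρ) (enc A (fun ρ))

open Tm public

infixr 4 _▸_

data Tms (Γ : List Ty) : List Ty → Set where
  ε : Tms Γ []
  _▸_ : ∀ {A Δ} → Tm Γ A → Tms Γ Δ → Tms Γ (A ∷ Δ)

funs : ∀ {Γ Δ} → Tms Γ Δ → Env Γ → Env Δ
funs ε _ = tt
funs (t ▸ ts) ρ = fun t ρ , funs ts ρ

codes : ∀ {Γ Δ} → Tms Γ Δ → Vec (PR (length Γ)) (length Δ)
codes ε = []
codes (t ▸ ts) = code t ∷ codes ts

oks : ∀ {Γ Δ} (ts : Tms Γ Δ) ρ → EvalVec (codes ts) (encEnv Γ ρ) (encEnv Δ (funs ts ρ))
oks ε ρ = evv-nil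
oks (t ▸ ts) ρ = evv-cons (ok t ρ) (oks ts ρ)

-- Keeps the program and exchanges the function for a pointwise equal one, the one used in the
-- mathematics.
recast : ∀ {Γ A} (t : Tm Γ A) (f : Env Γ → ⟦ A ⟧) → (∀ ρ → fun t ρ ≡ f ρ) → Tm Γ A
recast {Γ} {A} t f e = tm f (code t) λ ρ → subst (λ v → Eval (code t) (encEnv Γ ρ) (enc A v)) (e ρ) (ok t ρ)

var : ∀ {Γ A} → Γ ∋ A → Tm Γ A
var {Γ} x = tm (get x) (proj (idx x)) λ ρ → subst (Eval _ _) (lookup-encEnv x ρ) ev-proj

call : ∀ {Γ Δ A} → Tm Δ A → Tms Γ Δ → Tm Γ A
call f ts = tm (λ ρ → fun f (funs ts ρ)) (comp (code f) (codes ts)) λ ρ → ev-comp (oks ts ρ) (ok f (funs ts ρ))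

natrec : ∀ {A : Set} → A → (ℕ → A → A) → ℕ → A
natrec z s zero = z
natrec z s (suc n) = s n (natrec z s n)

projs : ∀ {m n} → (Fin m → Fin n) → Vec (PR n) m
projs σ = tabulate (λ i → proj (σ i))

eval-projs : ∀ {m n} (σ : Fin m → Fin n) xs → EvalVec (projs σ) xs (tabulate (λ i → lookup xs (σ i)))
eval-projs {zero} σ xs = evv-nil
eval-projs {suc m} σ xs = evv-cons ev-proj (eval-projs (σ ∘ suc) xs)

eval-projs-id : ∀ {n} (xs : Vec ℕ n) → EvalVec (projs (λ i → i)) xs xs
eval-projs-id xs = subst (EvalVec _ xs) (tabulate∘lookup xs) (eval-projs (λ i → i) xs)

recᵗ : ∀ {Γ A} → Tm Γ A → Tm (N ∷ A ∷ Γ) A → Tm Γ N → Tm Γ A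
recᵗ {Γ} {A} z s n = tm
  (λ ρ → natrec (fun z ρ) (λ k a → fun s (k , a , ρ)) (fun n ρ))
  (comp (prim (code z) (code s)) (code n ∷ projs (λ i → i)))
  λ ρ → ev-comp (evv-cons (ok n ρ) (eval-projs-id _)) (go ρ (fun n ρ))
  where
  go : ∀ ρ k → Eval (prim (code z) (code s)) (k ∷ encEnv Γ ρ)
                    (enc A (natrec (fun z ρ) (λ k a → fun s (k , a , ρ)) k))
  go ρ zero = ev-prim0 (ok z ρ)
  go ρ (suc k) = ev-primS (go ρ k) (ok s (k , _ , ρ))

constCode : ∀ {n} → ℕ → PR n
constCode zero = zeroF
constCode (suc k) = comp succF (constCode k ∷ [])

eval-const : ∀ {n} (xs : Vec ℕ n) k → Eval (constCode k) xs k
eval-const xs zero = ev-zero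
eval-const xs (suc k) = ev-comp (evv-cons (eval-const xs k) evv-nil) ev-succ

const : ∀ {Γ A} → ⟦ A ⟧ → Tm Γ A
const {A = A} a = tm (λ _ → a) (constCode (enc A a)) λ ρ → eval-const _ _

sucᵗ : ∀ {Γ} → Tm Γ N → Tm Γ N
sucᵗ t = tm (λ ρ → suc (fun t ρ)) (comp succF (code t ∷ [])) λ ρ → ev-comp (evv-cons (ok t ρ) evv-nil) ev-succ

-- Case distinction as recursion on the code of the Boolean: `true` takes the base case, and the
-- projection in the step skips counter, previous value and first branch.
if-eta : ∀ A (b : Bool) (x y : ⟦ A ⟧) →
  Eval (prim (proj zero) (proj (suc (suc (suc zero))))) (enc B b ∷ enc A x ∷ enc A y ∷ []) (enc A (if b then x else y))
if-eta A true x y = ev-prim0 ev-proj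
if-eta A false x y = ev-primS (ev-prim0 ev-proj) ev-proj

ifᵗ : ∀ {Γ A} → Tm Γ B → Tm Γ A → Tm Γ A → Tm Γ A
ifᵗ {Γ} {A} b t u = tm
  (λ ρ → if fun b ρ then fun t ρ else fun u ρ)
  (comp (prim (proj zero) (proj (suc (suc (suc zero))))) (code b ∷ code t ∷ code u ∷ []))
  λ ρ → ev-comp (evv-cons (ok b ρ) (evv-cons (ok t ρ) (evv-cons (ok u ρ) evv-nil)))
                (if-eta A (fun b ρ) (fun t ρ) (fun u ρ))

v0 : ∀ {Γ A} → Tm (A ∷ Γ) A
v0 = var here
v1 : ∀ {Γ A A₀} → Tm (A₀ ∷ A ∷ Γ) A
v1 = var (there here)
v2 : ∀ {Γ A A₀ A₁} → Tm (A₀ ∷ A₁ ∷ A ∷ Γ) A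
v2 = var (there (there here))
v3 : ∀ {Γ A A₀ A₁ A₂} → Tm (A₀ ∷ A₁ ∷ A₂ ∷ A ∷ Γ) A
v3 = var (there (there (there here)))
v4 : ∀ {Γ A A₀ A₁ A₂ A₃} → Tm (A₀ ∷ A₁ ∷ A₂ ∷ A₃ ∷ A ∷ Γ) A
v4 = var (there (there (there (there here))))

-- Arithmetic, data structures and search

add : Tm (N ∷ N ∷ []) N
add = recast (recᵗ v1 (sucᵗ v1) v0) (λ (m , n , _) → m + n) λ (m , n , _) → go m n
  where
  go : ∀ m n → natrec n (λ _ a → suc a) m ≡ m + n
  go zero n = refl
  go (suc m) n = cong suc (go m n)

predᵗ : Tm (N ∷ []) N
predᵗ = recast (recᵗ (const 0) v0 v0) (λ (n , _) → pred n) λ { (zero , _) → refl ; (suc n , _) → refl }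

monus : Tm (N ∷ N ∷ []) N
monus = recast (recᵗ v0 (call predᵗ (v1 ▸ ε)) v1) (λ (m , n , _) → m ∸ n) λ (m , n , _) → go m n
  where
  go : ∀ m n → natrec m (λ _ a → pred a) n ≡ m ∸ n
  go m zero = refl
  go m (suc n) = trans (cong pred (go m n)) (pred[m∸n]≡m∸[1+n] m n)

mul : Tm (N ∷ N ∷ []) N
mul = recast (recᵗ (const 0) (call add (v3 ▸ v1 ▸ ε)) v0) (λ (m , n , _) → m * n) λ (m , n , _) → go m n
  where
  go : ∀ m n → natrec 0 (λ _ a → n + a) m ≡ m * n
  go zero n = refl
  go (suc m) n = cong (n +_) (go m n)

infixl 6 _+ᵗ_ _∸ᵗ_
infixl 7 _*ᵗ_

_+ᵗ_ _∸ᵗ_ _*ᵗ_ : ∀ {Γ} → Tm Γ N → Tm Γ N → Tm Γ N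
t +ᵗ u = call add (t ▸ u ▸ ε)
t ∸ᵗ u = call monus (t ▸ u ▸ ε)
t *ᵗ u = call mul (t ▸ u ▸ ε)

isZero : ℕ → Bool
isZero zero = true
isZero (suc _) = false

eval-sign : ∀ n → Eval (prim zeroF (constCode 1)) (n ∷ []) (enc B (isZero n))
eval-sign zero = ev-prim0 ev-zero
eval-sign (suc n) = ev-primS (eval-sign n) (eval-const _ 1)

isZeroᵗ : Tm (N ∷ []) B
isZeroᵗ = tm (λ (n , _) → isZero n) (prim zeroF (constCode 1)) λ (n , _) → eval-sign n

equal : Tm (N ∷ N ∷ []) B
equal = recast (call isZeroᵗ ((v0 ∸ᵗ v1) +ᵗ (v1 ∸ᵗ v0) ▸ ε)) (λ (m , n , _) → m ≡ᵇ n) λ (m , n , _) → go m n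
  where
  go : ∀ m n → isZero ((m ∸ n) + (n ∸ m)) ≡ (m ≡ᵇ n)
  go zero zero = refl
  go zero (suc n) = refl
  go (suc m) zero = refl
  go (suc m) (suc n) = go m n

less : Tm (N ∷ N ∷ []) B
less = recast (call isZeroᵗ (sucᵗ v0 ∸ᵗ v1 ▸ ε)) (λ (m , n , _) → m <ᵇ n) λ (m , n , _) → go m n
  where
  go : ∀ m n → isZero (suc m ∸ n) ≡ (m <ᵇ n)
  go zero zero = refl
  go zero (suc n) = cong isZero (0∸n≡0 n)
  go (suc m) zero = refl
  go (suc m) (suc n) = go m n

infix 4 _≡ᵗ_ _<ᵗ_
infixr 3 _∧ᵗ_
infixr 2 _∨ᵗ_

_≡ᵗ_ _<ᵗ_ : ∀ {Γ} → Tm Γ N → Tm Γ N → Tm Γ B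
t ≡ᵗ u = call equal (t ▸ u ▸ ε)
t <ᵗ u = call less (t ▸ u ▸ ε)

_∧ᵗ_ _∨ᵗ_ : ∀ {Γ} → Tm Γ B → Tm Γ B → Tm Γ B
t ∧ᵗ u = recast (ifᵗ t u (const false)) (λ ρ → fun t ρ ∧ fun u ρ) λ ρ → go (fun t ρ)
  where
  go : ∀ b {c} → (if b then c else false) ≡ b ∧ c
  go true = refl
  go false = refl
t ∨ᵗ u = recast (ifᵗ t (const true) u) (λ ρ → fun t ρ ∨ fun u ρ) λ ρ → go (fun t ρ)
  where
  go : ∀ b {c} → (if b then true else c) ≡ b ∨ c
  go true = refl
  go false = refl

notᵗ : ∀ {Γ} → Tm Γ B → Tm Γ B
notᵗ t = recast (ifᵗ t (const false) (const true)) (λ ρ → not (fun t ρ)) λ ρ → go (fun t ρ)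
  where
  go : ∀ b → (if b then false else true) ≡ not b
  go true = refl
  go false = refl

triᵗ : Tm (N ∷ []) N
triᵗ = recast (recᵗ (const 0) (sucᵗ (v0 +ᵗ v1)) v0) (λ (n , _) → tri n) λ (n , _) → go n
  where
  go : ∀ n → natrec 0 (λ k a → suc (k + a)) n ≡ tri n
  go zero = refl
  go (suc n) = cong (λ a → suc (n + a)) (go n)

rootᵗ : Tm (N ∷ []) N
rootᵗ = recast (recᵗ (const 0) (ifᵗ (sucᵗ v0 ≡ᵗ call triᵗ (sucᵗ v1 ▸ ε)) (sucᵗ v1) v1) v0)
  (λ (n , _) → root n) λ (n , _) → go n
  where
  next : ℕ → ℕ → ℕ
  next k a = if suc k ≡ᵇ tri (suc a) then suc a else a
  go : ∀ n → natrec 0 next n ≡ root n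
  go zero = refl
  go (suc n) = cong (next n) (go n)

π₁ᵗ π₂ᵗ : Tm (N ∷ []) N
π₁ᵗ = recast (v0 ∸ᵗ call triᵗ (call rootᵗ (v0 ▸ ε) ▸ ε)) (λ (n , _) → π₁ n) λ (n , _) → sym (π₁-def n)
π₂ᵗ = recast (call rootᵗ (v0 ▸ ε) ∸ᵗ call π₁ᵗ (v0 ▸ ε)) (λ (n , _) → π₂ n) λ (n , _) → sym (π₂-def n)

pairN : Tm (N ∷ N ∷ []) N
pairN = recast (v0 +ᵗ call triᵗ (v0 +ᵗ v1 ▸ ε)) (λ (a , b , _) → pair a b) λ (a , b , _) → sym (pair-def a b)

infixr 4 _,ᵗ_

_,ᵗ_ : ∀ {Γ A A′} → Tm Γ A → Tm Γ A′ → Tm Γ (A ⊗ A′)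
t ,ᵗ u = tm (λ ρ → fun t ρ , fun u ρ) (comp (code pairN) (code t ∷ code u ∷ []))
  λ ρ → ev-comp (evv-cons (ok t ρ) (evv-cons (ok u ρ) evv-nil)) (ok pairN (_ , _ , tt))

through : ∀ {Γ A A′} (g : ⟦ A ⟧ → ⟦ A′ ⟧) (c : Tm (N ∷ []) N) →
  (∀ a → fun c (enc A a , tt) ≡ enc A′ (g a)) → Tm Γ A → Tm Γ A′
through {A = A} g c e t = tm (λ ρ → g (fun t ρ)) (comp (code c) (code t ∷ []))
  λ ρ → ev-comp (evv-cons (ok t ρ) evv-nil) (subst (Eval _ _) (e (fun t ρ)) (ok c (_ , tt)))

fstᵗ : ∀ {Γ A A′} → Tm Γ (A ⊗ A′) → Tm Γ A
fstᵗ = through proj₁ π₁ᵗ λ (a , b) → π₁-pair _ _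

sndᵗ : ∀ {Γ A A′} → Tm Γ (A ⊗ A′) → Tm Γ A′
sndᵗ {A = A} = through proj₂ π₂ᵗ λ (a , b) → π₂-pair (enc A a) _

codeᵗ : ∀ {Γ A} → Tm Γ A → Tm Γ N
codeᵗ {A = A} = through (enc A) v0 λ _ → refl

decTreeᵗ : ∀ {Γ} → Tm Γ N → Tm Γ T
decTreeᵗ = through decTree v0 λ n → sym (enc-decTree n)

[]ᵗ : ∀ {Γ A} → Tm Γ (L A)
[]ᵗ = const []

infixr 5 _∷ᵗ_

_∷ᵗ_ : ∀ {Γ A} → Tm Γ A → Tm Γ (L A) → Tm Γ (L A)
_∷ᵗ_ {A = A} t u = tm (λ ρ → fun t ρ ∷ fun u ρ) (code (sucᵗ (codeᵗ (t ,ᵗ u)))) (ok (sucᵗ (codeᵗ (t ,ᵗ u))))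

hd : ∀ A → List ⟦ A ⟧ → ⟦ A ⟧
hd A [] = default A
hd A (a ∷ _) = a

tl : ∀ {A : Set} → List A → List A
tl [] = []
tl (_ ∷ l) = l

isNil : ∀ {A : Set} → List A → Bool
isNil [] = true
isNil (_ ∷ _) = false

hdᵗ : ∀ {Γ A} → Tm Γ (L A) → Tm Γ A
hdᵗ {A = A} = through (hd A) (call π₁ᵗ (call predᵗ (v0 ▸ ε) ▸ ε))
  λ { [] → trans π₁-0 (sym (enc-default A)) ; (a ∷ l) → π₁-pair _ _ }

tlᵗ : ∀ {Γ A} → Tm Γ (L A) → Tm Γ (L A)
tlᵗ {A = A} = through tl (call π₂ᵗ (call predᵗ (v0 ▸ ε) ▸ ε)) λ { [] → π₂-0 ; (a ∷ l) → π₂-pair (enc A a) _ }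

isNilᵗ : ∀ {Γ A} → Tm Γ (L A) → Tm Γ B
isNilᵗ = through isNil (codeᵗ isZeroᵗ) λ { [] → refl ; (_ ∷ _) → refl }

isLeaf : Tree → Bool
isLeaf leaf = true
isLeaf (node _ _ _) = false

tag : Tree → ℕ
tag leaf = 0
tag (node n _ _) = n

left right : Tree → Tree
left leaf = leaf
left (node _ l _) = l
right leaf = leaf
right (node _ _ r) = r

isLeafᵗ : ∀ {Γ} → Tm Γ T → Tm Γ B
isLeafᵗ = through isLeaf (codeᵗ isZeroᵗ) λ { leaf → refl ; (node _ _ _) → refl }

tagᵗ : ∀ {Γ} → Tm Γ T → Tm Γ N
tagᵗ = through tag (call π₁ᵗ (call predᵗ (v0 ▸ ε) ▸ ε)) λ { leaf → π₁-0 ; (node _ _ _) → π₁-pair _ _ }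

leftᵗ rightᵗ : ∀ {Γ} → Tm Γ T → Tm Γ T
leftᵗ = through left (call π₁ᵗ (call π₂ᵗ (call predᵗ (v0 ▸ ε) ▸ ε) ▸ ε))
  λ { leaf → trans (cong π₁ π₂-0) π₁-0 ; (node n l r) → trans (cong π₁ (π₂-pair n _)) (π₁-pair _ _) }
rightᵗ = through right (call π₂ᵗ (call π₂ᵗ (call predᵗ (v0 ▸ ε) ▸ ε) ▸ ε))
  λ { leaf → trans (cong π₂ π₂-0) π₂-0 ; (node n l r) → trans (cong π₂ (π₂-pair n _)) (π₂-pair (encTree l) _) }

nodeᵗ : ∀ {Γ} → ℕ → Tm Γ T → Tm Γ T → Tm Γ T
nodeᵗ n t u = tm (λ ρ → node n (fun t ρ) (fun u ρ)) (code (sucᵗ (codeᵗ (const {A = N} n ,ᵗ t ,ᵗ u))))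
  (ok (sucᵗ (codeᵗ (const {A = N} n ,ᵗ t ,ᵗ u))))

-- A list is at most as long as its code, which bounds the number of iterations.
module _ {Γ A C} (s : Tm (A ∷ C ∷ Γ) C) where

  private
    next : Env Γ → List ⟦ A ⟧ × ⟦ C ⟧ → List ⟦ A ⟧ × ⟦ C ⟧
    next ρ (l , c) = if isNil l then (l , c) else (tl l , fun s (hd A l , c , ρ))

    iterate : Env Γ → ℕ → List ⟦ A ⟧ × ⟦ C ⟧ → List ⟦ A ⟧ × ⟦ C ⟧
    iterate ρ n p = natrec p (λ _ → next ρ) n

    iterate-suc : ∀ ρ n p → iterate ρ (suc n) p ≡ iterate ρ n (next ρ p)
    iterate-suc ρ zero p = refl
    iterate-suc ρ (suc n) p = cong (next ρ) (iterate-suc ρ n p)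

    iterate-foldl : ∀ ρ n l c → length l ≤ n →
      proj₂ (iterate ρ n (l , c)) ≡ foldl (λ c a → fun s (a , c , ρ)) c l
    iterate-foldl ρ zero [] c _ = refl
    iterate-foldl ρ (suc n) [] c _ = trans (cong proj₂ (iterate-suc ρ n ([] , c))) (iterate-foldl ρ n [] c z≤n)
    iterate-foldl ρ (suc n) (a ∷ l) c (s≤s le) =
      trans (cong proj₂ (iterate-suc ρ n (a ∷ l , c))) (iterate-foldl ρ n l _ le)

    length≤enc : ∀ l → length l ≤ enc (L A) l
    length≤enc [] = z≤n
    length≤enc (a ∷ l) = s≤s (≤-trans (length≤enc l) (pair≥₂ (enc A a) _))

    step : Tm (N ∷ (L A ⊗ C) ∷ Γ) (L A ⊗ C)
    step = ifᵗ (isNilᵗ (fstᵗ v1)) v1 (tlᵗ (fstᵗ v1) ,ᵗ body)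
      where
      body : Tm (N ∷ (L A ⊗ C) ∷ Γ) C
      body = tm (λ (_ , p , ρ) → fun s (hd A (proj₁ p) , proj₂ p , ρ))
        -- `s` expects the parameters of `Γ` alone, so the projections skip the counter and the
        -- accumulated pair.
        (comp (code s) (code (hdᵗ (fstᵗ v)) ∷ code (sndᵗ v) ∷ projs (λ i → suc (suc i))))
        λ r@(_ , p , ρ) → ev-comp
          (evv-cons (ok (hdᵗ (fstᵗ v)) r) (evv-cons (ok (sndᵗ v) r)
            (subst (EvalVec _ _) (tabulate∘lookup _) (eval-projs (λ i → suc (suc i)) _))))
          (ok s _)
        where
        v : Tm (N ∷ (L A ⊗ C) ∷ Γ) (L A ⊗ C)
        v = v1

  foldlᵗ : Tm Γ C → Tm Γ (L A) → Tm Γ C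
  foldlᵗ z l = recast (sndᵗ (recᵗ (l ,ᵗ z) step (codeᵗ l)))
    (λ ρ → foldl (λ c a → fun s (a , c , ρ)) (fun z ρ) (fun l ρ))
    λ ρ → iterate-foldl ρ (enc (L A) (fun l ρ)) (fun l ρ) (fun z ρ) (length≤enc (fun l ρ))

reverseᵗ : ∀ {Γ A} → Tm Γ (L A) → Tm Γ (L A)
reverseᵗ l = foldlᵗ (v0 ∷ᵗ v1) []ᵗ l

foldrᵗ : ∀ {Γ A C} → Tm (A ∷ C ∷ Γ) C → Tm Γ C → Tm Γ (L A) → Tm Γ C
foldrᵗ s z l = recast (foldlᵗ s z (reverseᵗ l))
  (λ ρ → foldr (λ a c → fun s (a , c , ρ)) (fun z ρ) (fun l ρ))
  λ ρ → reverse-foldl (λ c a → fun s (a , c , ρ)) (fun z ρ) (fun l ρ)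

least : (p : ℕ → Bool) → ∀ n → p n ≡ true → ∃[ m ] p m ≡ true × (∀ z → z < m → p z ≡ false)
least p zero pn = 0 , pn , λ _ ()
least p (suc n) pn with p 0 in eq
... | true = 0 , eq , λ _ ()
... | false with least (p ∘ suc) n pn
... | m , pm , min = suc m , pm , λ { zero _ → eq ; (suc z) (s≤s z<m) → min z z<m }

search : ∀ {Γ} (t : Tm (N ∷ Γ) B) → (∀ ρ → ∃[ n ] fun t (n , ρ) ≡ true) → Env Γ → ℕ
search t e ρ = proj₁ (least (λ n → fun t (n , ρ)) (proj₁ (e ρ)) (proj₂ (e ρ)))

search-true : ∀ {Γ} (t : Tm (N ∷ Γ) B) e ρ → fun t (search t e ρ , ρ) ≡ true
search-true t e ρ = proj₁ (proj₂ (least (λ n → fun t (n , ρ)) (proj₁ (e ρ)) (proj₂ (e ρ))))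

eval-search : ∀ {Γ} (t : Tm (N ∷ Γ) B) ρ m → fun t (m , ρ) ≡ true →
  (∀ z → z < m → fun t (z , ρ) ≡ false) → Eval (mu (code t)) (encEnv Γ ρ) m
eval-search {Γ} t ρ m pm min = ev-mu (value m true pm) λ z z<m → 0 , value z false (min z z<m)
  where
  value : ∀ z b → fun t (z , ρ) ≡ b → Eval (code t) (z ∷ encEnv Γ ρ) (enc B b)
  value z b e = subst (λ b → Eval (code t) (z ∷ encEnv Γ ρ) (enc B b)) e (ok t (z , ρ))

searchᵗ : ∀ {Γ} (t : Tm (N ∷ Γ) B) → (∀ ρ → ∃[ n ] fun t (n , ρ) ≡ true) → Tm Γ N
searchᵗ t e = tm (search t e) (mu (code t)) λ ρ →
  let m , pm , min = least (λ n → fun t (n , ρ)) (proj₁ (e ρ)) (proj₂ (e ρ)) in eval-search t ρ m pm min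

enc-true : ∀ b → 0 ≡ enc B b → b ≡ true
enc-true true _ = refl

-- Minimisation halts exactly when some `s` makes `t` true, so it enumerates the relation.
∃-ce : ∀ {R : BinRel} (t : Tm (N ∷ N ∷ N ∷ []) B) →
  (∀ x y → R x y ⇔ (∃[ s ] fun t (s , x , y , tt) ≡ true)) → CE R
∃-ce {R} t h = mu (code t) , λ x y → mk⇔ (to x y) (from x y)
  where
  to : ∀ x y → R x y → ∃[ v ] Eval (mu (code t)) (x ∷ y ∷ []) v
  to x y r with Equivalence.to (h x y) r
  ... | s , p with least (λ n → fun t (n , x , y , tt)) s p
  ... | m , pm , min = m , eval-search t (x , y , tt) m pm min
  from : ∀ x y → ∃[ v ] Eval (mu (code t)) (x ∷ y ∷ []) v → R x y
  from x y (v , ev-mu p _) = Equivalence.from (h x y) (v , enc-true _ (eval-det p (ok t (v , x , y , tt))))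

toComputable : (t : Tm (N ∷ []) N) → Computable (λ x → fun t (x , tt))
toComputable t = code t , λ x → ok t (x , tt)

oracle : ∀ {f} → Computable f → Tm (N ∷ []) N
oracle {f} (c , e) = tm (λ (x , _) → f x) c λ (x , _) → e x

-- A universal machine

-- In a state (c , xs , ys , k) the program c, run on the arguments xs, pushes its
-- value on ys and returns to the continuation k; a frame (c , xs) of k receives the
-- pushed values as its ys. The tags are: 0 zero, 1 successor, 2 evaluation of an
-- argument vector from the back, 3 composition, 4 its return point, 5 recursion,
-- 6 its return point, 7 minimisation, 8 one trial of it, 9 the test of that trial,
-- 10 empty vector, 11 + i projection.
Frame State : Ty
Frame = T ⊗ L N
State = T ⊗ L N ⊗ L N ⊗ L Frame

infixr 0 _⇒_∣_
_⇒_∣_ : ∀ {Γ A} → Tm Γ B → Tm Γ A → Tm Γ A → Tm Γ A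
_⇒_∣_ = ifᵗ

nth : ℕ → List ℕ → ℕ
nth i xs = hd N (natrec xs (λ _ → tl) i)

stepCode : Tm (T ∷ L N ∷ L N ∷ L Frame ∷ []) State
stepCode =
  isLeafᵗ c ⇒ (isNilᵗ k ⇒ (c ,ᵗ xs ,ᵗ ys ,ᵗ k) ∣ (fstᵗ (hdᵗ k) ,ᵗ sndᵗ (hdᵗ k) ,ᵗ ys ,ᵗ tlᵗ k)) ∣
  is 0 ⇒ return (const 0 ∷ᵗ ys) ∣
  is 1 ⇒ return (sucᵗ (hdᵗ xs) ∷ᵗ ys) ∣
  is 2 ⇒ (rightᵗ c ,ᵗ xs ,ᵗ ys ,ᵗ (leftᵗ c ,ᵗ xs) ∷ᵗ k) ∣
  -- The value stack is put aside in the frame: at tag 4 the argument values are in `ys` and the old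
  -- stack is in `xs`. Tags 6 and 9 also find the old stack in `xs`.
  is 3 ⇒ (rightᵗ c ,ᵗ xs ,ᵗ []ᵗ ,ᵗ (nodeᵗ 4 (leftᵗ c) (const leaf) ,ᵗ ys) ∷ᵗ k) ∣
  is 4 ⇒ (leftᵗ c ,ᵗ ys ,ᵗ xs ,ᵗ k) ∣
  is 5 ⇒ ((hdᵗ xs ≡ᵗ const 0) ⇒ (leftᵗ c ,ᵗ tlᵗ xs ,ᵗ ys ,ᵗ k) ∣
          -- The arguments double as value stack of the recursive call, which leaves value, counter
          -- and parameters for tag 6 to reorder. Tag 8 keeps its candidate in the same way.
          (c ,ᵗ down ,ᵗ down ,ᵗ (nodeᵗ 6 (rightᵗ c) (const leaf) ,ᵗ ys) ∷ᵗ k)) ∣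
  is 6 ⇒ (leftᵗ c ,ᵗ (hdᵗ (tlᵗ ys) ∷ᵗ hdᵗ ys ∷ᵗ tlᵗ (tlᵗ ys)) ,ᵗ xs ,ᵗ k) ∣
  is 7 ⇒ (nodeᵗ 8 (leftᵗ c) (const leaf) ,ᵗ (const 0 ∷ᵗ xs) ,ᵗ ys ,ᵗ k) ∣
  is 8 ⇒ (leftᵗ c ,ᵗ xs ,ᵗ xs ,ᵗ (nodeᵗ 9 (leftᵗ c) (const leaf) ,ᵗ ys) ∷ᵗ k) ∣
  is 9 ⇒ ((hdᵗ ys ≡ᵗ const 0) ⇒ return (hdᵗ (tlᵗ ys) ∷ᵗ xs) ∣
          (nodeᵗ 8 (leftᵗ c) (const leaf) ,ᵗ (sucᵗ (hdᵗ (tlᵗ ys)) ∷ᵗ tlᵗ (tlᵗ ys)) ,ᵗ xs ,ᵗ k)) ∣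
  is 10 ⇒ return ys ∣
  return (hdᵗ (recᵗ xs (tlᵗ v1) (tagᵗ c ∸ᵗ const 11)) ∷ᵗ ys)
  where
  Γ = T ∷ L N ∷ L N ∷ L Frame ∷ []
  c : Tm Γ T
  c = v0
  xs ys down : Tm Γ (L N)
  xs = v1
  ys = v2
  down = (hdᵗ xs ∸ᵗ const 1) ∷ᵗ tlᵗ xs
  k : Tm Γ (L Frame)
  k = v3
  is : ℕ → Tm Γ B
  is n = tagᵗ c ≡ᵗ const n
  return : Tm Γ (L N) → Tm Γ State
  return zs = const leaf ,ᵗ []ᵗ ,ᵗ zs ,ᵗ k

stepᵗ : Tm (State ∷ []) State
stepᵗ = call stepCode (fstᵗ v0 ▸ fstᵗ (sndᵗ v0) ▸ fstᵗ (sndᵗ (sndᵗ v0)) ▸ sndᵗ (sndᵗ (sndᵗ v0)) ▸ ε)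

step : ⟦ State ⟧ → ⟦ State ⟧
step st = fun stepᵗ (st , tt)

steps : ℕ → ⟦ State ⟧ → ⟦ State ⟧
steps zero st = st
steps (suc n) st = steps n (step st)

stepsᵗ : Tm (N ∷ State ∷ []) State
stepsᵗ = recast (recᵗ v1 (call stepᵗ (v1 ▸ ε)) v0) (λ (n , st , _) → steps n st) λ (n , st , _) → go n st
  where
  shift : ∀ n st → step (steps n st) ≡ steps n (step st)
  shift zero st = refl
  shift (suc n) st = shift n (step st)
  go : ∀ n st → natrec st (λ _ → step) n ≡ steps n st
  go zero st = refl
  go (suc n) st = trans (cong step (go n st)) (shift n st)

haltedᵗ : Tm (State ∷ []) B
haltedᵗ = isLeafᵗ (fstᵗ v0) ∧ᵗ isNilᵗ (sndᵗ (sndᵗ (sndᵗ v0)))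

halted : ⟦ State ⟧ → Bool
halted st = fun haltedᵗ (st , tt)

step-halted : ∀ st → halted st ≡ true → step st ≡ st
step-halted (leaf , xs , ys , []) _ = refl

steps-halted : ∀ n st → halted st ≡ true → steps n st ≡ st
steps-halted zero st h = refl
steps-halted (suc n) st h rewrite step-halted st h = steps-halted n st h

mutual
  ⌜_⌝ : ∀ {n} → PR n → Tree
  ⌜ zeroF ⌝ = node 0 leaf leaf
  ⌜ succF ⌝ = node 1 leaf leaf
  ⌜ proj i ⌝ = node (11 + toℕ i) leaf leaf
  ⌜ comp f gs ⌝ = node 3 ⌜ f ⌝ ⌜ gs ⌝ᵛ
  ⌜ prim f g ⌝ = node 5 ⌜ f ⌝ ⌜ g ⌝
  ⌜ mu f ⌝ = node 7 ⌜ f ⌝ leaf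

  ⌜_⌝ᵛ : ∀ {m n} → Vec (PR n) m → Tree
  ⌜ [] ⌝ᵛ = node 10 leaf leaf
  ⌜ g ∷ gs ⌝ᵛ = node 2 ⌜ g ⌝ ⌜ gs ⌝ᵛ

infix 4 _↠_

data _↠_ : ⟦ State ⟧ → ⟦ State ⟧ → Set where
  stop : ∀ {st} → st ↠ st
  more : ∀ {st st′} → step st ↠ st′ → st ↠ st′

infixr 5 _⨾_

_⨾_ : ∀ {s t u} → s ↠ t → t ↠ u → s ↠ u
stop ⨾ q = q
more p ⨾ q = more (p ⨾ q)

tl-nth : ∀ i x (xs : List ℕ) → natrec (x ∷ xs) (λ _ → tl) (suc i) ≡ natrec xs (λ _ → tl) i
tl-nth zero x xs = refl
tl-nth (suc i) x xs = cong tl (tl-nth i x xs)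

nth-lookup : ∀ {n} (i : Fin n) xs → nth (toℕ i) (toList xs) ≡ lookup xs i
nth-lookup zero (x ∷ xs) = refl
nth-lookup (suc i) (x ∷ xs) = trans (cong (hd N) (tl-nth (toℕ i) x (toList xs))) (nth-lookup i xs)

mutual
  -- The stack and the continuation are arbitrary so that runs of subprograms can be chained.
  run : ∀ {n} {c : PR n} {xs v} → Eval c xs v → ∀ ys k →
    (⌜ c ⌝ , toList xs , ys , k) ↠ (leaf , [] , v ∷ ys , k)
  run ev-zero ys k = more stop
  run ev-succ ys k = more stop
  run (ev-proj {i = i} {xs}) ys k =
    more (subst (λ v → (leaf , [] , nth (toℕ i) (toList xs) ∷ ys , k) ↠ (leaf , [] , v ∷ ys , k)) (nth-lookup i xs) stop)
  run (ev-comp {f = f} {xs = xs} {vs} ps p) ys k =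
    more (runArgs ps (node 4 ⌜ f ⌝ leaf) ys k ⨾ more (run p ys k))
  run (ev-prim0 p) ys k = more (run p ys k)
  run (ev-primS {f = f} {g} p q) ys k = more (run p _ _ ⨾ more (more (run q ys k)))
  run (ev-mu {f = f} {xs} {y} p h) ys k =
    more (climb y ≤-refl ⨾ more (run p _ _ ⨾ more (more stop)))
    where
    -- Below `y` every trial has a positive value, so tag 9 passes to the next candidate.
    climb : ∀ z → z ≤ y →
      (node 8 ⌜ f ⌝ leaf , 0 ∷ toList xs , ys , k) ↠ (node 8 ⌜ f ⌝ leaf , z ∷ toList xs , ys , k)
    climb zero _ = stop
    climb (suc z) z<y with h z z<y
    ... | v , q = climb z (<⇒≤ z<y) ⨾ more (run q _ _ ⨾ more (more stop))

  runVec : ∀ {m n} {cs : Vec (PR n) m} {xs vs} → EvalVec cs xs vs → ∀ ys k →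
    (⌜ cs ⌝ᵛ , toList xs , ys , k) ↠ (leaf , [] , toList vs ++ ys , k)
  runVec evv-nil ys k = more stop
  runVec (evv-cons p ps) ys k = more (runVec ps ys _ ⨾ more (run p _ k))

  runArgs : ∀ {m n} {cs : Vec (PR n) m} {xs vs} → EvalVec cs xs vs → ∀ c ys k →
    (⌜ cs ⌝ᵛ , toList xs , [] , (c , ys) ∷ k) ↠ (c , ys , toList vs , k)
  runArgs {vs = vs} ps c ys k = subst (λ zs → _ ↠ (c , ys , zs , k)) (++-identityʳ (toList vs))
    (runVec ps [] ((c , ys) ∷ k) ⨾ more stop)

Diverges : ⟦ State ⟧ → Set
Diverges st = ∀ n → halted (steps n st) ≢ true

-- Halted states are fixed by `step`, so the number of steps still needed cannot grow along a run.
halt-later : ∀ {s t} → s ↠ t → ∀ n → halted (steps n s) ≡ true → ∃[ m ] m ≤ n × halted (steps m t) ≡ true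
halt-later stop n h = n , ≤-refl , h
halt-later {s} (more p) zero h = halt-later p zero (trans (cong halted (step-halted s h)) h)
halt-later (more p) (suc n) h with halt-later p n h
... | m , m≤n , h′ = m , m≤n⇒m≤1+n m≤n , h′

diverges-back : ∀ {s t} → s ↠ t → Diverges t → Diverges s
diverges-back p d n h with halt-later p n h
... | m , _ , h′ = d m h′

-- A converging run yields an evaluation since, classically, every program without one diverges.
module Soundness (em : ExcludedMiddle 0ℓ) where

  mutual
    total? : ∀ {n} (c : PR n) xs →
      (∃[ v ] Eval c xs v) ⊎ (∀ ys k → Diverges (⌜ c ⌝ , toList xs , ys , k))
    total? zeroF xs = inj₁ (0 , ev-zero)
    total? succF (x ∷ []) = inj₁ (suc x , ev-succ)
    total? (proj i) xs = inj₁ (lookup xs i , ev-proj)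
    total? (comp f gs) xs with totalVec? gs xs
    ... | inj₂ d = inj₂ λ ys k → diverges-back (more stop) (d [] _)
    ... | inj₁ (vs , ps) with total? f vs
    ... | inj₁ (v , p) = inj₁ (v , ev-comp ps p)
    ... | inj₂ d = inj₂ λ ys k → diverges-back (more (runArgs ps _ ys k ⨾ more stop)) (d ys k)
    total? (prim f g) (k ∷ xs) = go k
      where
      go : ∀ j → (∃[ v ] Eval (prim f g) (j ∷ xs) v) ⊎
                 (∀ ys k → Diverges (⌜ prim f g ⌝ , j ∷ toList xs , ys , k))
      go zero with total? f xs
      ... | inj₁ (v , p) = inj₁ (v , ev-prim0 p)
      ... | inj₂ d = inj₂ λ ys k → diverges-back (more stop) (d ys k)
      go (suc j) with go j
      ... | inj₂ d = inj₂ λ ys k → diverges-back (more stop) (d _ _)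
      ... | inj₁ (v , p) with total? g (j ∷ v ∷ xs)
      ... | inj₁ (w , q) = inj₁ (w , ev-primS p q)
      ... | inj₂ d = inj₂ λ ys k → diverges-back (more (run p _ _ ⨾ more (more stop))) (d ys k)
    -- The search is unbounded, so the induction hypothesis alone does not decide this case.
    total? (mu f) xs with em {∃[ v ] Eval (mu f) xs v}
    ... | yes e = inj₁ e
    ... | no ne = inj₂ λ ys k → diverges-back (more stop) λ n → loop ys k n n ≤-refl 0 λ _ ()
      where
      -- `b` bounds the remaining steps and drops with every failed trial. A trial with value 0
      -- would complete an evaluation, and a diverging one never halts.
      loop : ∀ ys k b n → n ≤ b → ∀ z → (∀ w → w < z → ∃[ v ] Eval f (w ∷ xs) (suc v)) →
        halted (steps n (node 8 ⌜ f ⌝ leaf , z ∷ toList xs , ys , k)) ≢ true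
      loop ys k (suc b) (suc n) (s≤s n≤b) z below h with total? f (z ∷ xs)
      ... | inj₂ d = d _ _ n h
      ... | inj₁ (zero , p) = ne (z , ev-mu p below)
      ... | inj₁ (suc v , p) with halt-later (run p _ _ ⨾ more (more stop)) n h
      ... | m , m≤n , h′ = loop ys k b m (≤-trans m≤n n≤b) (suc z) below′ h′
        where
        below′ : ∀ w → w < suc z → ∃[ v ] Eval f (w ∷ xs) (suc v)
        below′ w (s≤s w≤z) with m≤n⇒m<n∨m≡n w≤z
        ... | inj₁ w<z = below w w<z
        ... | inj₂ refl = v , p

    totalVec? : ∀ {m n} (cs : Vec (PR n) m) xs →
      (∃[ vs ] EvalVec cs xs vs) ⊎ (∀ ys k → Diverges (⌜ cs ⌝ᵛ , toList xs , ys , k))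
    totalVec? [] xs = inj₁ ([] , evv-nil)
    totalVec? (g ∷ gs) xs with totalVec? gs xs
    ... | inj₂ d = inj₂ λ ys k → diverges-back (more stop) (d ys _)
    ... | inj₁ (vs , ps) with total? g xs
    ... | inj₁ (v , p) = inj₁ (v ∷ vs , evv-cons p ps)
    ... | inj₂ d = inj₂ λ ys k → diverges-back (more (runVec ps ys _ ⨾ more stop)) (d _ k)

  halts⇒eval : ∀ {n} (c : PR n) xs s → halted (steps s (⌜ c ⌝ , toList xs , [] , [])) ≡ true → ∃[ v ] Eval c xs v
  halts⇒eval c xs s h with total? c xs
  ... | inj₁ e = e
  ... | inj₂ d = contradiction h (d [] [] s)

↠⇒steps : ∀ {s t} → s ↠ t → halted t ≡ true → ∃[ n ] (∀ m → n ≤ m → steps m s ≡ t)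
↠⇒steps {s} stop h = 0 , λ m _ → steps-halted m s h
↠⇒steps (more p) h with ↠⇒steps p h
... | n , e = suc n , λ { (suc m) (s≤s n≤m) → e m n≤m }

eval⇒halts : ∀ {n} {c : PR n} {xs v} → Eval c xs v →
  ∃[ s ] (∀ m → s ≤ m → steps m (⌜ c ⌝ , toList xs , [] , []) ≡ (leaf , [] , v ∷ [] , []))
eval⇒halts p = ↠⇒steps (run p [] []) refl

-- Labels and actions

-- A label (i , c) stands for the element c of the i-th ceer. A map (p , l , l′) sends
-- column p to l and every other column to l′. An action (s , k , a , m , m′) of
-- requirement k at stage s relabels the numbers below s whose column is at least k + 2,
-- by m on side a and by m′ on the other sides. Lists of actions are newest first.
Label LabelMap Action : Ty
Label = N ⊗ N
LabelMap = N ⊗ Label ⊗ Label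
Action = N ⊗ N ⊗ N ⊗ LabelMap ⊗ LabelMap

free : ℕ → ⟦ Label ⟧ → Bool
free k l = suc k <ᵇ proj₁ l

apply : ⟦ LabelMap ⟧ → ℕ → ⟦ Label ⟧
apply (p , l , l′) i = if i ≡ᵇ p then l else l′

relabelFree : ℕ → ⟦ LabelMap ⟧ → ⟦ Label ⟧ → ⟦ Label ⟧
relabelFree k m l = if free k l then apply m (proj₁ l) else l

relabel : ⟦ Action ⟧ → ℕ → ⟦ Label ⟧ → ⟦ Label ⟧
relabel (s , k , a , m , m′) n l =
  if n <ᵇ s then relabelFree k (if π₁ n ≡ᵇ a then m else m′) l else l

-- n = pair a (pair i (pair c t)) lies on side a and is born with label (i , c); t only
-- provides late numbers with that label.
birth : ℕ → ⟦ Label ⟧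
birth n = π₁ (π₂ n) , π₁ (π₂ (π₂ n))

label : List ⟦ Action ⟧ → ℕ → ⟦ Label ⟧
label h n = foldr (λ α → relabel α n) (birth n) h

-- The action of k counts until a requirement of smaller index acts.
satisfied : ℕ → List ⟦ Action ⟧ → Bool
satisfied k h = foldr (λ α r → if proj₁ (proj₂ α) <ᵇ suc k then proj₁ (proj₂ α) ≡ᵇ k else r) false h

differ : ⟦ Label ⟧ → ⟦ Label ⟧ → Bool
differ l l′ = not (proj₁ l ≡ᵇ proj₁ l′)

attackable : ℕ → (l₁ l₁′ l₂ l₂′ : ⟦ Label ⟧) → Bool
attackable k l₁ l₁′ l₂ l₂′ = free k l₁ ∧ (free k l₂ ∨ free k l₂′) ∧ (differ l₁ l₁′ ∨ differ l₂ l₂′)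

-- Columns 0 and 1 are protected from every requirement; a free column is sent to the
-- one of them that differs from the other column to be separated.
separate : ⟦ Label ⟧ → ⟦ Label ⟧ → ⟦ LabelMap ⟧
separate (p , _) (q , _) = p , ((if q ≡ᵇ 0 then 1 else 0) , 0) , ((if p ≡ᵇ 1 then 0 else 1) , 0)

-- A fixed label cannot move, so a free partner joins it; two free labels meet in the protected
-- column 0.
meeting : ℕ → ⟦ Label ⟧ → ⟦ Label ⟧ → ⟦ Label ⟧
meeting k l l′ = if free k l then (if free k l′ then (0 , 0) else l′) else l

-- The two targets coincide, so the column 0 in the test is a placeholder.
merge : ℕ → ⟦ Label ⟧ → ⟦ Label ⟧ → ⟦ LabelMap ⟧
merge k l l′ = 0 , meeting k l l′ , meeting k l l′

attack : ℕ → (l₁ l₁′ l₂ l₂′ : ⟦ Label ⟧) → ⟦ LabelMap ⊗ LabelMap ⟧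
attack k l₁ l₁′ l₂ l₂′ =
  if differ l₂ l₂′ then (merge k l₁ l₁′ , separate l₂ l₂′) else (separate l₁ l₁′ , merge k l₂ l₂′)

start : Tree → ℕ → ⟦ State ⟧
start e x = e , x ∷ [] , [] , []

converges : Tree → ℕ → ℕ → Bool
converges e x s = halted (steps s (start e x))

value : Tree → ℕ → ℕ → ℕ
value e x s = hd N (proj₁ (proj₂ (proj₂ (steps s (start e x)))))

-- Requirement pair (pair a e) (pair b e′) concerns the functions computed by e and e′,
-- as reductions to the sides a and b.
sideL sideR : ℕ → ℕ
sideL k = π₁ (π₁ k)
sideR k = π₁ (π₂ k)

progL progR : ℕ → Tree
progL k = decTree (π₂ (π₁ k))
progR k = decTree (π₂ (π₂ k))

req arg arg′ : ℕ → ℕ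
req s = π₁ s
arg s = π₁ (π₂ s)
arg′ s = π₁ (π₂ (π₂ s))

-- Stage s considers requirement req s at the pair of arguments arg s, arg′ s;
-- every combination recurs at arbitrarily late stages.
elL elL′ elR elR′ : ℕ → ℕ
elL s = pair (sideL (req s)) (value (progL (req s)) (arg s) s)
elL′ s = pair (sideL (req s)) (value (progL (req s)) (arg′ s) s)
elR s = pair (sideR (req s)) (value (progR (req s)) (arg s) s)
elR′ s = pair (sideR (req s)) (value (progR (req s)) (arg′ s) s)

computed : ℕ → Bool
computed s =
  converges (progL (req s)) (arg s) s ∧ converges (progL (req s)) (arg′ s) s ∧
  converges (progR (req s)) (arg s) s ∧ converges (progR (req s)) (arg′ s) s

-- Actions relabel only numbers below `s`, and the two maps of an attack can be chosen independently
-- only for different sides.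
inRange : ℕ → Bool
inRange s = (elL s <ᵇ s) ∧ (elL′ s <ᵇ s) ∧ (elR s <ᵇ s) ∧ (elR′ s <ᵇ s) ∧ not (sideL (req s) ≡ᵇ sideR (req s))

ready : ℕ → List ⟦ Action ⟧ → Bool
ready s h = computed s ∧ inRange s ∧ not (satisfied (req s) h) ∧
  attackable (req s) (label h (elL s)) (label h (elL′ s)) (label h (elR s)) (label h (elR′ s))

attacks : ℕ → List ⟦ Action ⟧ → ⟦ LabelMap ⊗ LabelMap ⟧
attacks s h = attack (req s) (label h (elL s)) (label h (elL′ s)) (label h (elR s)) (label h (elR′ s))

-- Single relabellings and attacks

col : ⟦ Label ⟧ → ℕ
col = proj₁

<ᵇ-true : ∀ m n → (m <ᵇ n) ≡ true → m < n
<ᵇ-true m (suc n) p = <ᵇ⇒< m (suc n) (subst BT (sym p) tt)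

<⇒<ᵇ-true : ∀ {m n} → m < n → (m <ᵇ n) ≡ true
<⇒<ᵇ-true {m} {n} lt with m <ᵇ n | <⇒<ᵇ lt
... | true | _ = refl

≮⇒<ᵇ-false : ∀ {m n} → ¬ m < n → (m <ᵇ n) ≡ false
≮⇒<ᵇ-false {m} {n} nlt with m <ᵇ n in eq
... | true = contradiction (<ᵇ-true m n eq) nlt
... | false = refl

∧-true : ∀ {a b} → a ∧ b ≡ true → a ≡ true × b ≡ true
∧-true {true} p = refl , p

∨-true : ∀ {a b} → a ∨ b ≡ true → a ≡ true ⊎ b ≡ true
∨-true {true} p = inj₁ refl
∨-true {false} p = inj₂ p

not-true : ∀ {b} → not b ≡ true → b ≡ false
not-true {false} _ = refl

data FreeView (k : ℕ) (l : ⟦ Label ⟧) : Set where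
  isFree : free k l ≡ true → suc k < col l → FreeView k l
  isFixed : free k l ≡ false → col l ≤ suc k → FreeView k l

freeView : ∀ k l → FreeView k l
freeView k l with free k l in eq
... | true = isFree eq (<ᵇ-true _ _ eq)
... | false = isFixed eq (≮⇒≥ λ lt → contradiction (trans (sym (<⇒<ᵇ-true lt)) eq) λ ())

differ-true : ∀ l l′ → differ l l′ ≡ true → col l ≢ col l′
differ-true l l′ p refl = contradiction (trans (sym p) (cong not (≡ᵇ-refl (col l)))) λ ()

differ-false : ∀ l l′ → differ l l′ ≡ false → col l ≡ col l′
differ-false l l′ p with col l ≡ᵇ col l′ in eq
... | true = ≡ᵇ-true _ _ eq

-- Columns up to `k + 1` are fixed for every requirement from `k` on, so such targets are safe from
-- all of them.
record Low (k : ℕ) (m : ⟦ LabelMap ⟧) : Set where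
  constructor low
  field
    low₁ : col (proj₁ (proj₂ m)) ≤ suc k
    low₂ : col (proj₂ (proj₂ m)) ≤ suc k

apply-low : ∀ {k m} → Low k m → ∀ i → col (apply m i) ≤ suc k
apply-low {m = p , _} (low a b) i with i ≡ᵇ p
... | true = a
... | false = b

meeting-low : ∀ k l l′ → col (meeting k l l′) ≤ suc k
meeting-low k l l′ with freeView k l | freeView k l′
... | isFree e _ | isFree e′ _ rewrite e | e′ = z≤n
... | isFree e _ | isFixed e′ le rewrite e | e′ = le
... | isFixed e le | _ rewrite e = le

merge-low : ∀ k l l′ → Low k (merge k l l′)
merge-low k l l′ = low (meeting-low k l l′) (meeting-low k l l′)

separate-low : ∀ k l l′ → Low k (separate l l′)
separate-low k (p , _) (q , _) = low (go (q ≡ᵇ 0)) (go′ (p ≡ᵇ 1))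
  where
  go : ∀ b → (if b then 1 else 0) ≤ suc k
  go true = s≤s z≤n
  go false = z≤n
  go′ : ∀ b → (if b then 0 else 1) ≤ suc k
  go′ true = z≤n
  go′ false = s≤s z≤n

attack-low : ∀ k l₁ l₁′ l₂ l₂′ → Low k (proj₁ (attack k l₁ l₁′ l₂ l₂′)) × Low k (proj₂ (attack k l₁ l₁′ l₂ l₂′))
attack-low k l₁ l₁′ l₂ l₂′ with differ l₂ l₂′
... | true = merge-low k l₁ l₁′ , separate-low k l₂ l₂′
... | false = separate-low k l₁ l₁′ , merge-low k l₂ l₂′

relabelFree-low : ∀ {k m} → Low k m → ∀ l → col (relabelFree k m l) ≤ suc k
relabelFree-low {k} {m} lw l with freeView k l
... | isFree e _ rewrite e = apply-low lw (col l)
... | isFixed e le rewrite e = le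

relabelFree-fixed : ∀ k m l → col l ≤ suc k → relabelFree k m l ≡ l
relabelFree-fixed k m l le rewrite ≮⇒<ᵇ-false (≤⇒≯ le) = refl

relabelFree-≤ : ∀ {k m} → Low k m → ∀ l → col (relabelFree k m l) ≤ col l
relabelFree-≤ {k} {m} lw l with freeView k l
... | isFree e lt rewrite e = ≤-trans (apply-low lw (col l)) (<⇒≤ lt)
... | isFixed e le rewrite e = ≤-refl

apply-const : ∀ p l i → apply (p , l , l) i ≡ l
apply-const p l i with i ≡ᵇ p
... | true = refl
... | false = refl

merge-merges : ∀ k l l′ → free k l ∨ free k l′ ≡ true →
  relabelFree k (merge k l l′) l ≡ relabelFree k (merge k l l′) l′
merge-merges k l l′ h with freeView k l | freeView k l′
... | isFree e _ | isFree e′ _ rewrite e | e′ = trans (apply-const 0 _ (col l)) (sym (apply-const 0 _ (col l′)))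
... | isFree e _ | isFixed e′ _ rewrite e | e′ = apply-const 0 _ (col l)
... | isFixed e _ | isFree e′ _ rewrite e | e′ = sym (apply-const 0 _ (col l′))
... | isFixed e _ | isFixed e′ _ rewrite e | e′ = contradiction h λ ()

separate-separates : ∀ k l l′ → free k l ∨ free k l′ ≡ true → col l ≢ col l′ →
  col (relabelFree k (separate l l′) l) ≢ col (relabelFree k (separate l l′) l′)
separate-separates k l@(p , _) l′@(q , _) h p≢q with freeView k l | freeView k l′
... | isFixed e _ | isFixed e′ _ rewrite e | e′ = contradiction h λ ()
-- Free columns are at least 2, so both tests in `separate` fail and the targets are columns 0 and
-- 1.
... | isFree e lt | isFree e′ lt′
  rewrite e | e′ | ≡ᵇ-refl p | ≢⇒≡ᵇ q p (p≢q ∘ sym)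
        | ≢⇒≡ᵇ q 0 (λ { refl → contradiction lt′ λ () })
        | ≢⇒≡ᵇ p 1 (λ { refl → contradiction lt λ { (s≤s ()) } }) = λ ()
... | isFree e lt | isFixed e′ _ rewrite e | e′ | ≡ᵇ-refl p = go q
  where
  go : ∀ q → (if q ≡ᵇ 0 then 1 else 0) ≢ q
  go zero ()
  go (suc q) ()
... | isFixed e _ | isFree e′ lt′ rewrite e | e′ | ≢⇒≡ᵇ q p (p≢q ∘ sym) = go p
  where
  go : ∀ p → p ≢ (if p ≡ᵇ 1 then 0 else 1)
  go zero ()
  go (suc zero) ()
  go (suc (suc p)) ()

if-true : ∀ {A : Set} {b} {x y : A} → b ≡ true → (if b then x else y) ≡ x
if-true refl = refl

if-false : ∀ {A : Set} {b} {x y : A} → b ≡ false → (if b then x else y) ≡ y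
if-false refl = refl

true≢false : ∀ {b} {A : Set} → b ≡ true → b ≡ false → A
true≢false refl ()

Disagree : (l₁ l₁′ l₂ l₂′ : ⟦ Label ⟧) → Set
Disagree l₁ l₁′ l₂ l₂′ = (l₁ ≡ l₁′ × col l₂ ≢ col l₂′) ⊎ (col l₁ ≢ col l₁′ × l₂ ≡ l₂′)

-- Each pair has a free member, so either can be merged. The second pair is separated if its columns
-- differ; otherwise those of the first must differ.
attack-disagrees : ∀ k l₁ l₁′ l₂ l₂′ → attackable k l₁ l₁′ l₂ l₂′ ≡ true →
  let m , m′ = attack k l₁ l₁′ l₂ l₂′ in
  Disagree (relabelFree k m l₁) (relabelFree k m l₁′) (relabelFree k m′ l₂) (relabelFree k m′ l₂′)
attack-disagrees k l₁ l₁′ l₂ l₂′ h with ∧-true {free k l₁} h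
... | f₁ , h′ with ∧-true {free k l₂ ∨ free k l₂′} h′
... | f₂ , d with differ l₂ l₂′ in eq
... | true = inj₁ (merge-merges k l₁ l₁′ (cong (_∨ free k l₁′) f₁) ,
                   separate-separates k l₂ l₂′ f₂ (differ-true l₂ l₂′ eq))
... | false with ∨-true {differ l₁ l₁′} d
... | inj₁ d₁ = inj₂ (separate-separates k l₁ l₁′ (cong (_∨ free k l₁′) f₁) (differ-true l₁ l₁′ d₁) ,
                      merge-merges k l₂ l₂′ f₂)

disagree-resp : ∀ {l₁ l₁′ l₂ l₂′ m₁ m₁′ m₂ m₂′} → l₁ ≡ m₁ → l₁′ ≡ m₁′ → l₂ ≡ m₂ → l₂′ ≡ m₂′ →
  Disagree m₁ m₁′ m₂ m₂′ → Disagree l₁ l₁′ l₂ l₂′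
disagree-resp refl refl refl refl d = d

record Same (A : ℕ → BinRel) (l l′ : ⟦ Label ⟧) : Set where
  constructor same
  field
    col-same : col l ≡ col l′
    val-same : A (col l) (proj₂ l) (proj₂ l′)

-- A map sees only the column, so two labels of one column both stay or both move to the same label,
-- where reflexivity suffices.
relabelFree-same : ∀ {A} → (∀ i {c} → A i c c) → ∀ k m {l l′} → Same A l l′ →
  Same A (relabelFree k m l) (relabelFree k m l′)
relabelFree-same r k m {i , c} {.i , d} (same refl h) with suc k <ᵇ i
... | true = same refl (r _)
... | false = same refl h

-- The dynamics depend only on the targets of the relabellings being protected
-- and on a satisfied requirement not acting.
module Dynamics
  (ready : ℕ → List ⟦ Action ⟧ → Bool)
  (side : ℕ → ℕ)
  (maps : ℕ → List ⟦ Action ⟧ → ⟦ LabelMap ⊗ LabelMap ⟧)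
  (maps-low : ∀ s h → Low (req s) (proj₁ (maps s h)) × Low (req s) (proj₂ (maps s h)))
  (unsatisfied : ∀ s h → ready s h ≡ true → satisfied (req s) h ≡ false)
  where

  action : ℕ → List ⟦ Action ⟧ → ⟦ Action ⟧
  action s h = s , req s , side s , maps s h

  stage : ℕ → List ⟦ Action ⟧ → List ⟦ Action ⟧
  stage s h = if ready s h then action s h ∷ h else h

  actions : ℕ → List ⟦ Action ⟧
  actions s = natrec [] stage s

  labelAt : ℕ → ℕ → ⟦ Label ⟧
  labelAt s n = label (actions s) n

  Ready : ℕ → Set
  Ready s = ready s (actions s) ≡ true

  Quiet : ℕ → ℕ → Set
  Quiet k s = ∀ t → s ≤ t → Ready t → k ≤ req t

  quiet-later : ∀ {k s t} → s ≤ t → Quiet k s → Quiet k t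
  quiet-later s≤t q u t≤u = q u (≤-trans s≤t t≤u)

  actions-ready : ∀ s → Ready s → actions (suc s) ≡ action s (actions s) ∷ actions s
  actions-ready s r = cong (λ b → if b then action s (actions s) ∷ actions s else actions s) r

  actions-idle : ∀ s → ready s (actions s) ≡ false → actions (suc s) ≡ actions s
  actions-idle s r = cong (λ b → if b then action s (actions s) ∷ actions s else actions s) r

  mapFor : ℕ → ℕ → ⟦ LabelMap ⟧
  mapFor s n = if π₁ n ≡ᵇ side s then proj₁ (maps s (actions s)) else proj₂ (maps s (actions s))

  mapFor-low : ∀ s n → Low (req s) (mapFor s n)
  mapFor-low s n = choose (π₁ n ≡ᵇ side s) (maps-low s (actions s))
    where
    choose : ∀ {k m m′} b → Low k m × Low k m′ → Low k (if b then m else m′)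
    choose true (a , _) = a
    choose false (_ , b) = b

  mapFor-side : ∀ s {n n′} → π₁ n ≡ π₁ n′ → mapFor s n ≡ mapFor s n′
  mapFor-side s {n} {n′} e = cong (λ a → if a ≡ᵇ side s then proj₁ (maps s (actions s)) else proj₂ (maps s (actions s))) e

  mapFor-own : ∀ s n → π₁ n ≡ side s → mapFor s n ≡ proj₁ (maps s (actions s))
  mapFor-own s n e = if-true (trans (cong (_≡ᵇ side s) e) (≡ᵇ-refl (side s)))

  mapFor-other : ∀ s n → π₁ n ≢ side s → mapFor s n ≡ proj₂ (maps s (actions s))
  mapFor-other s n ne = if-false (≢⇒≡ᵇ (π₁ n) (side s) ne)

  -- The condition in `kept` makes two numbers below `s` comparable: if one of them is moved, an
  -- action took place and the other is treated too.
  data Step (s n : ℕ) : Set where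
    kept : labelAt (suc s) n ≡ labelAt s n → (n < s → ready s (actions s) ≡ false) → Step s n
    moved : Ready s → n < s → labelAt (suc s) n ≡ relabelFree (req s) (mapFor s n) (labelAt s n) → Step s n

  readyView : ∀ s → Ready s ⊎ ready s (actions s) ≡ false
  readyView s = view (ready s (actions s))
    where
    view : ∀ b → b ≡ true ⊎ b ≡ false
    view true = inj₁ refl
    view false = inj₂ refl

  stepView : ∀ s n → Step s n
  stepView s n with readyView s
  ... | inj₂ idle = kept (cong (λ h → label h n) (actions-idle s idle)) λ _ → idle
  ... | inj₁ r with n <? s
  ... | yes n<s = moved r n<s (trans (cong (λ h → label h n) (actions-ready s r)) (if-true (<⇒<ᵇ-true n<s)))
  ... | no n≮s = kept (trans (cong (λ h → label h n) (actions-ready s r)) (if-false (≮⇒<ᵇ-false n≮s)))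
      λ n<s → contradiction n<s n≮s

  label-≤ : ∀ s n → col (labelAt (suc s) n) ≤ col (labelAt s n)
  label-≤ s n with stepView s n
  ... | kept e _ = ≤-reflexive (cong col e)
  ... | moved _ _ e = ≤-trans (≤-reflexive (cong col e)) (relabelFree-≤ (mapFor-low s n) (labelAt s n))

  from-stage : (P : ℕ → Set) → ∀ {s} → P s → (∀ t → s ≤ t → P t → P (suc t)) → ∀ t → s ≤ t → P t
  from-stage P {s} ps st t s≤t = go (≤⇒≤′ s≤t)
    where
    go : ∀ {t} → s ≤′ t → P t
    go ≤′-refl = ps
    go (≤′-step le) = st _ (≤′⇒≤ le) (go le)

  label-mono : ∀ {s} n t → s ≤ t → col (labelAt t n) ≤ col (labelAt s n)
  label-mono {s} n = from-stage (λ t → col (labelAt t n) ≤ col (labelAt s n)) ≤-refl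
    λ t _ le → ≤-trans (label-≤ t n) le

  -- Only requirements from `k` on still act, and to them the columns up to `k + 1` are fixed.
  stable : ∀ {k s} n → Quiet k s → col (labelAt s n) ≤ suc k → ∀ t → s ≤ t → labelAt t n ≡ labelAt s n
  stable {k} {s} n q le = from-stage (λ t → labelAt t n ≡ labelAt s n) refl go
    where
    go : ∀ t → s ≤ t → labelAt t n ≡ labelAt s n → labelAt (suc t) n ≡ labelAt s n
    go t s≤t ih with stepView t n
    ... | kept e _ = trans e ih
    ... | moved r _ e = trans e (trans (relabelFree-fixed (req t) (mapFor t n) (labelAt t n)
            (≤-trans (≤-reflexive (cong col ih)) (≤-trans le (s≤s (q t s≤t r))))) ih)

  -- An action at stage `t` touches only numbers below `t`, so even stage `n` leaves `n` alone.
  unborn-label : ∀ n t → t ≤ suc n → labelAt t n ≡ birth n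
  unborn-label n zero _ = refl
  unborn-label n (suc t) (s≤s t≤n) with stepView t n
  ... | kept e _ = trans e (unborn-label n t (m≤n⇒m≤1+n t≤n))
  ... | moved _ n<t _ = contradiction t≤n (<⇒≱ n<t)

  Satisfied : ℕ → ℕ → Set
  Satisfied k s = satisfied k (actions s) ≡ true

  satisfied-skip : ∀ k s → (Ready s → k < req s) → satisfied k (actions (suc s)) ≡ satisfied k (actions s)
  satisfied-skip k s f with readyView s
  ... | inj₂ idle = cong (satisfied k) (actions-idle s idle)
  ... | inj₁ r = trans (cong (satisfied k) (actions-ready s r)) (if-false (≮⇒<ᵇ-false (≤⇒≯ (f r))))

  satisfied-acts : ∀ s → Ready s → Satisfied (req s) (suc s)
  satisfied-acts s r = trans (cong (satisfied (req s)) (actions-ready s r))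
    (trans (if-true (<⇒<ᵇ-true (n<1+n (req s)))) (≡ᵇ-refl (req s)))

  satisfied-higher : ∀ k s → Ready s → req s < k → satisfied k (actions (suc s)) ≡ false
  satisfied-higher k s r lt = trans (cong (satisfied k) (actions-ready s r))
    (trans (if-true (<⇒<ᵇ-true (m≤n⇒m≤1+n lt))) (≢⇒≡ᵇ (req s) k (<⇒≢ lt)))

  Acted : ℕ → ℕ → ℕ → Set
  Acted k s₀ s = Ready s₀ × req s₀ ≡ k × (∀ t → s₀ < t → t < s → Ready t → k < req t)

  acted-later : ∀ {k s₀ s} → (Ready s → k < req s) → Acted k s₀ s → Acted k s₀ (suc s)
  acted-later {k} {s₀} {s} f (r₀ , e , q) = r₀ , e , go
    where
    go : ∀ t → s₀ < t → t < suc s → Ready t → k < req t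
    go t s₀<t (s≤s t≤s) r with m≤n⇒m<n∨m≡n t≤s
    ... | inj₁ t<s = q t s₀<t t<s r
    ... | inj₂ refl = f r

  -- Going back in time, the last action of an index up to `k` decides, and it must be one of `k`.
  satisfied-origin : ∀ k s → Satisfied k s → ∃[ s₀ ] Acted k s₀ s
  satisfied-origin k (suc s) h = go (readyView s)
    where
    later : (Ready s → k < req s) → ∃[ s₀ ] Acted k s₀ (suc s)
    later f with satisfied-origin k s (trans (sym (satisfied-skip k s f)) h)
    ... | s₀ , a = s₀ , acted-later f a
    go : Ready s ⊎ ready s (actions s) ≡ false → ∃[ s₀ ] Acted k s₀ (suc s)
    go (inj₂ idle) = later λ r → true≢false r idle
    go (inj₁ r) with <-cmp (req s) k
    ... | tri< lt _ _ = true≢false h (satisfied-higher k s r lt)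
    ... | tri≈ _ e _ = s , r , e , λ { t s<t (s≤s t≤s) _ → contradiction t≤s (<⇒≱ s<t) }
    ... | tri> _ _ gt = later λ _ → gt

  quiet-suc : ∀ {k s} → (∀ t → s ≤ t → Ready t → k ≢ req t) → Quiet k s → Quiet (suc k) s
  quiet-suc ne q t s≤t r = ≤∧≢⇒< (q t s≤t r) (ne t s≤t r)

  -- Only a smaller index could cancel the satisfaction, and those are silent; `k` itself is not
  -- ready while satisfied.
  satisfied-persists : ∀ {k s} → Quiet k s → Satisfied k s → ∀ t → s ≤ t → Satisfied k t
  satisfied-persists {k} {s} q sat = from-stage (Satisfied k) sat λ t s≤t ih →
    trans (satisfied-skip k t λ r → ≤∧≢⇒< (q t s≤t r) λ e →
      true≢false (subst (λ j → Satisfied j t) e ih) (unsatisfied t _ r)) ih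

  unsatisfied-persists : ∀ {k s} → Quiet (suc k) s → satisfied k (actions s) ≡ false →
    ∀ t → s ≤ t → satisfied k (actions t) ≡ false
  unsatisfied-persists {k} {s} q unsat = from-stage (λ t → satisfied k (actions t) ≡ false) unsat
    λ t s≤t ih → trans (satisfied-skip k t (q t s≤t)) ih

  -- Finite injury and limit labels

  module Injury (em : ExcludedMiddle 0ℓ) where

    -- Once the indices below `k` are silent, an action of `k` satisfies it for good, so it acts at
    -- most once more.
    quiet : ∀ k → ∃[ s ] Quiet k s
    quiet zero = 0 , λ _ _ _ → z≤n
    quiet (suc k) with quiet k
    ... | s , q with em {∃[ t ] s ≤ t × Ready t × k ≡ req t}
    ... | no none = s , quiet-suc (λ t s≤t r e → none (t , s≤t , r , e)) q
    ... | yes (t , s≤t , r , refl) = suc t , quiet-suc never (quiet-later (m≤n⇒m≤1+n s≤t) q)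
      where
      never : ∀ u → suc t ≤ u → Ready u → req t ≢ req u
      never u t<u ru e = true≢false
        (satisfied-persists (quiet-later (m≤n⇒m≤1+n s≤t) q) (satisfied-acts t r) u t<u)
        (subst (λ j → satisfied j (actions u) ≡ false) (sym e) (unsatisfied u _ ru))

    -- If `k` is satisfied once all indices up to `k` are silent, its last action was never injured;
    -- if not, it can never become satisfied, as that would take an action.
    outcome : ∀ k →
      (∃[ s ] Ready s × req s ≡ k × Quiet (suc k) (suc s)) ⊎
      (∃[ s ] Quiet (suc k) s × (∀ t → s ≤ t → satisfied k (actions t) ≡ false))
    outcome k with quiet (suc k)
    ... | s , q with satisfied k (actions s) in eq
    ... | false = inj₂ (s , q , unsatisfied-persists q eq)
    ... | true with satisfied-origin k s eq
    ... | s₀ , r , e , q₀ = inj₁ (s₀ , r , e , q′)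
      where
      q′ : Quiet (suc k) (suc s₀)
      q′ t s₀<t rt with s ≤? t
      ... | yes s≤t = q t s≤t rt
      ... | no s≰t = q₀ t s₀<t (≰⇒> s≰t) rt

    -- Columns never increase, so only requirements below the column at birth can move the label,
    -- and these fall silent.
    limit : ∀ n → ∃[ l ] ∃[ s ] (∀ t → s ≤ t → labelAt t n ≡ l)
    limit n with quiet (col (labelAt 0 n))
    ... | s , q = labelAt s n , s , stable n q (m≤n⇒m≤1+n (label-mono n s z≤n))

    lim : ℕ → ⟦ Label ⟧
    lim n = proj₁ (limit n)

    lim-at : ∀ {k s} n → Quiet (suc k) s → col (labelAt s n) ≤ suc k → lim n ≡ labelAt s n
    lim-at {k} {s} n q le = trans (sym (e (s ⊔ s′) (m≤n⊔m s s′)))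
      (stable n (λ t s≤t r → ≤-trans (n≤1+n k) (q t s≤t r)) le (s ⊔ s′) (m≤m⊔n s s′))
      where
      s′ = proj₁ (proj₂ (limit n))
      e = proj₂ (proj₂ (limit n))

    -- The action leaves every number below `s` in a column up to `req s + 1`, which no later action
    -- can move.
    settled : ∀ {s} n → Ready s → Quiet (suc (req s)) (suc s) → n < s →
      lim n ≡ relabelFree (req s) (mapFor s n) (labelAt s n)
    settled {s} n r q n<s with stepView s n
    ... | kept _ idle = true≢false r (idle n<s)
    ... | moved _ _ e = trans
      (lim-at n q (≤-trans (≤-reflexive (cong col e)) (relabelFree-low (mapFor-low s n) (labelAt s n)))) e

    lim-birth : ∀ {k s} n → Quiet (suc k) s → s ≤ n → col (birth n) ≤ suc k → lim n ≡ birth n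
    lim-birth {s = s} n q s≤n le = trans
      (lim-at n q (subst (λ l → col l ≤ _) (sym e) le)) e
      where
      e : labelAt s n ≡ birth n
      e = unborn-label n s (m≤n⇒m≤1+n s≤n)

    module _ {A : ℕ → BinRel} (A-refl : ∀ i {c} → A i c c) where

      -- Numbers of one side that are both below `s` undergo the same maps from then on. Agreement
      -- seen at one stage is therefore final, which makes the limit relation c.e.
      same-persists : ∀ {s n n′} → π₁ n ≡ π₁ n′ → n < s → n′ < s →
        Same A (labelAt s n) (labelAt s n′) → Same A (lim n) (lim n′)
      same-persists {s} {n} {n′} side≡ n<s n′<s h = subst₂ (Same A) (proj₂ (proj₂ (limit n)) t t≥) (proj₂ (proj₂ (limit n′)) t t≥′)
        (from-stage (λ t → Same A (labelAt t n) (labelAt t n′)) h go t (≤-trans (m≤m⊔n s _) (m≤m⊔n _ _)))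
        where
        t = (s ⊔ proj₁ (proj₂ (limit n))) ⊔ proj₁ (proj₂ (limit n′))
        t≥ : proj₁ (proj₂ (limit n)) ≤ t
        t≥ = ≤-trans (m≤n⊔m s _) (m≤m⊔n _ _)
        t≥′ : proj₁ (proj₂ (limit n′)) ≤ t
        t≥′ = m≤n⊔m (s ⊔ proj₁ (proj₂ (limit n))) _
        go : ∀ t → s ≤ t → Same A (labelAt t n) (labelAt t n′) → Same A (labelAt (suc t) n) (labelAt (suc t) n′)
        go t s≤t ih with stepView t n | stepView t n′
        ... | kept e _ | kept e′ _ = subst₂ (Same A) (sym e) (sym e′) ih
        ... | kept _ idle | moved r _ _ = true≢false r (idle (<-≤-trans n<s s≤t))
        ... | moved r _ _ | kept _ idle = true≢false r (idle (<-≤-trans n′<s s≤t))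
        ... | moved _ _ e | moved _ _ e′ = subst₂ (Same A) (sym e)
          (trans (cong (λ m → relabelFree (req t) m (labelAt t n′)) (mapFor-side t {n} {n′} side≡)) (sym e′))
          (relabelFree-same A-refl (req t) (mapFor t n) ih)

-- The dynamics of the actual construction

module _ {s : ℕ} {h : List ⟦ Action ⟧} (r : ready s h ≡ true) where

  private
    facts : computed s ≡ true × inRange s ∧ not (satisfied (req s) h) ∧ _ ≡ true
    facts = ∧-true {computed s} r
    facts₂ : inRange s ≡ true × not (satisfied (req s) h) ∧ _ ≡ true
    facts₂ = ∧-true {inRange s} (proj₂ facts)
    facts₃ : not (satisfied (req s) h) ≡ true × _
    facts₃ = ∧-true {not (satisfied (req s) h)} (proj₂ facts₂)

  ready-computed : computed s ≡ true
  ready-computed = proj₁ facts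

  ready-inRange : inRange s ≡ true
  ready-inRange = proj₁ facts₂

  ready-unsatisfied : satisfied (req s) h ≡ false
  ready-unsatisfied = not-true (proj₁ facts₃)

  ready-attackable : attackable (req s) (label h (elL s)) (label h (elL′ s)) (label h (elR s)) (label h (elR′ s)) ≡ true
  ready-attackable = proj₂ facts₃

computed-intro : ∀ s →
  converges (progL (req s)) (arg s) s ≡ true → converges (progL (req s)) (arg′ s) s ≡ true →
  converges (progR (req s)) (arg s) s ≡ true → converges (progR (req s)) (arg′ s) s ≡ true → computed s ≡ true
computed-intro s c₁ c₂ c₃ c₄ = cong₂ _∧_ c₁ (cong₂ _∧_ c₂ (cong₂ _∧_ c₃ c₄))

inRange-intro : ∀ s → elL s < s → elL′ s < s → elR s < s → elR′ s < s → sideL (req s) ≢ sideR (req s) → inRange s ≡ true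
inRange-intro s b₁ b₂ b₃ b₄ ne = cong₂ _∧_ (<⇒<ᵇ-true b₁) (cong₂ _∧_ (<⇒<ᵇ-true b₂) (cong₂ _∧_ (<⇒<ᵇ-true b₃)
  (cong₂ _∧_ (<⇒<ᵇ-true b₄) (cong not (≢⇒≡ᵇ _ _ ne)))))

ready-intro : ∀ s h → computed s ≡ true → inRange s ≡ true → satisfied (req s) h ≡ false →
  attackable (req s) (label h (elL s)) (label h (elL′ s)) (label h (elR s)) (label h (elR′ s)) ≡ true → ready s h ≡ true
ready-intro s h c i u a = cong₂ _∧_ c (cong₂ _∧_ i (cong₂ _∧_ (cong not u) a))

attacks-disagree : ∀ s h → ready s h ≡ true →
  Disagree (relabelFree (req s) (proj₁ (attacks s h)) (label h (elL s)))
           (relabelFree (req s) (proj₁ (attacks s h)) (label h (elL′ s)))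
           (relabelFree (req s) (proj₂ (attacks s h)) (label h (elR s)))
           (relabelFree (req s) (proj₂ (attacks s h)) (label h (elR′ s)))
attacks-disagree s h r = attack-disagrees (req s) (label h (elL s)) (label h (elL′ s)) (label h (elR s)) (label h (elR′ s))
  (ready-attackable {s} {h} r)

open Dynamics ready (λ s → sideL (req s)) attacks
  (λ s h → attack-low (req s) (label h (elL s)) (label h (elL′ s)) (label h (elR s)) (label h (elR′ s)))
  (λ s h r → ready-unsatisfied {s} {h} r) public

-- The construction is computable

freeᵗ : Tm (N ∷ Label ∷ []) B
freeᵗ = recast (sucᵗ v0 <ᵗ fstᵗ v1) (λ (k , l , _) → free k l) λ _ → refl

applyᵗ : Tm (LabelMap ∷ N ∷ []) Label
applyᵗ = recast (v1 ≡ᵗ fstᵗ v0 ⇒ fstᵗ (sndᵗ v0) ∣ sndᵗ (sndᵗ v0)) (λ (m , i , _) → apply m i) λ _ → refl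

relabelFreeᵗ : Tm (N ∷ LabelMap ∷ Label ∷ []) Label
relabelFreeᵗ = recast (call freeᵗ (v0 ▸ v2 ▸ ε) ⇒ call applyᵗ (v1 ▸ fstᵗ v2 ▸ ε) ∣ v2)
  (λ (k , m , l , _) → relabelFree k m l) λ _ → refl

π₁′ π₂′ : ∀ {Γ} → Tm Γ N → Tm Γ N
π₁′ t = call π₁ᵗ (t ▸ ε)
π₂′ t = call π₂ᵗ (t ▸ ε)

relabelᵗ : Tm (Action ∷ N ∷ Label ∷ []) Label
relabelᵗ = recast
  (v1 <ᵗ fstᵗ α ⇒
    call relabelFreeᵗ (fstᵗ (sndᵗ α) ▸
      (π₁′ v1 ≡ᵗ fstᵗ (sndᵗ (sndᵗ α)) ⇒ fstᵗ (sndᵗ (sndᵗ (sndᵗ α))) ∣ sndᵗ (sndᵗ (sndᵗ (sndᵗ α)))) ▸ v2 ▸ ε) ∣ v2)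
  (λ (α , n , l , _) → relabel α n l) λ _ → refl
  where
  α : Tm (Action ∷ N ∷ Label ∷ []) Action
  α = v0

labelᵗ : Tm (L Action ∷ N ∷ []) Label
labelᵗ = recast (foldrᵗ (call relabelᵗ (v0 ▸ v3 ▸ v1 ▸ ε)) (π₁′ (π₂′ v1) ,ᵗ π₁′ (π₂′ (π₂′ v1))) v0)
  (λ (h , n , _) → label h n) λ _ → refl

satisfiedᵗ : Tm (N ∷ L Action ∷ []) B
satisfiedᵗ = recast
  (foldrᵗ (fstᵗ (sndᵗ v0) <ᵗ sucᵗ v2 ⇒ fstᵗ (sndᵗ v0) ≡ᵗ v2 ∣ v1) (const false) v1)
  (λ (k , h , _) → satisfied k h) λ _ → refl

differᵗ : Tm (Label ∷ Label ∷ []) B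
differᵗ = recast (notᵗ (fstᵗ v0 ≡ᵗ fstᵗ v1)) (λ (l , l′ , _) → differ l l′) λ _ → refl

attackableᵗ : Tm (N ∷ Label ∷ Label ∷ Label ∷ Label ∷ []) B
attackableᵗ = recast
  (call freeᵗ (v0 ▸ v1 ▸ ε) ∧ᵗ (call freeᵗ (v0 ▸ v3 ▸ ε) ∨ᵗ call freeᵗ (v0 ▸ v4 ▸ ε)) ∧ᵗ
    (call differᵗ (v1 ▸ v2 ▸ ε) ∨ᵗ call differᵗ (v3 ▸ v4 ▸ ε)))
  (λ (k , l₁ , l₁′ , l₂ , l₂′ , _) → attackable k l₁ l₁′ l₂ l₂′) λ _ → refl

separateᵗ : Tm (Label ∷ Label ∷ []) LabelMap
separateᵗ = recast
  (fstᵗ v0 ,ᵗ ((fstᵗ v1 ≡ᵗ const 0 ⇒ const 1 ∣ const 0) ,ᵗ const 0) ,ᵗ ((fstᵗ v0 ≡ᵗ const 1 ⇒ const 0 ∣ const 1) ,ᵗ const 0))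
  (λ (l , l′ , _) → separate l l′) λ _ → refl

mergeᵗ : Tm (N ∷ Label ∷ Label ∷ []) LabelMap
mergeᵗ = recast (const 0 ,ᵗ w ,ᵗ w) (λ (k , l , l′ , _) → merge k l l′) λ _ → refl
  where
  w : Tm (N ∷ Label ∷ Label ∷ []) Label
  w = call freeᵗ (v0 ▸ v1 ▸ ε) ⇒ (call freeᵗ (v0 ▸ v2 ▸ ε) ⇒ const (0 , 0) ∣ v2) ∣ v1

attackᵗ : Tm (N ∷ Label ∷ Label ∷ Label ∷ Label ∷ []) (LabelMap ⊗ LabelMap)
attackᵗ = recast
  (call differᵗ (v3 ▸ v4 ▸ ε) ⇒
    (call mergeᵗ (v0 ▸ v1 ▸ v2 ▸ ε) ,ᵗ call separateᵗ (v3 ▸ v4 ▸ ε)) ∣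
    (call separateᵗ (v1 ▸ v2 ▸ ε) ,ᵗ call mergeᵗ (v0 ▸ v3 ▸ v4 ▸ ε)))
  (λ (k , l₁ , l₁′ , l₂ , l₂′ , _) → attack k l₁ l₁′ l₂ l₂′) λ _ → refl

runᵗ : Tm (T ∷ N ∷ N ∷ []) State
runᵗ = recast (call stepsᵗ (v2 ▸ (v0 ,ᵗ (v1 ∷ᵗ []ᵗ) ,ᵗ []ᵗ ,ᵗ []ᵗ) ▸ ε)) (λ (e , x , s , _) → steps s (start e x)) λ _ → refl

convergesᵗ : Tm (T ∷ N ∷ N ∷ []) B
convergesᵗ = recast (call haltedᵗ (runᵗ ▸ ε)) (λ (e , x , s , _) → converges e x s) λ _ → refl

valueᵗ : Tm (T ∷ N ∷ N ∷ []) N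
valueᵗ = recast (hdᵗ (fstᵗ (sndᵗ (sndᵗ runᵗ)))) (λ (e , x , s , _) → value e x s) λ _ → refl

module StageTerms where
  sideLᵗ sideRᵗ argᵗ argᵗ′ elLᵗ elLᵗ′ elRᵗ elRᵗ′ : Tm (N ∷ []) N
  sideLᵗ = π₁′ (π₁′ (π₁′ v0))
  sideRᵗ = π₁′ (π₂′ (π₁′ v0))
  argᵗ = π₁′ (π₂′ v0)
  argᵗ′ = π₁′ (π₂′ (π₂′ v0))

  progLᵗ progRᵗ : Tm (N ∷ []) T
  progLᵗ = decTreeᵗ (π₂′ (π₁′ (π₁′ v0)))
  progRᵗ = decTreeᵗ (π₂′ (π₂′ (π₁′ v0)))

  element : Tm (N ∷ []) N → Tm (N ∷ []) T → Tm (N ∷ []) N → Tm (N ∷ []) N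
  element a e x = call pairN (a ▸ call valueᵗ (e ▸ x ▸ v0 ▸ ε) ▸ ε)

  elLᵗ = recast (element sideLᵗ progLᵗ argᵗ) (λ (s , _) → elL s) λ _ → refl
  elLᵗ′ = recast (element sideLᵗ progLᵗ argᵗ′) (λ (s , _) → elL′ s) λ _ → refl
  elRᵗ = recast (element sideRᵗ progRᵗ argᵗ) (λ (s , _) → elR s) λ _ → refl
  elRᵗ′ = recast (element sideRᵗ progRᵗ argᵗ′) (λ (s , _) → elR′ s) λ _ → refl

  computedᵗ inRangeᵗ : Tm (N ∷ []) B
  computedᵗ = recast
    (call convergesᵗ (progLᵗ ▸ argᵗ ▸ v0 ▸ ε) ∧ᵗ call convergesᵗ (progLᵗ ▸ argᵗ′ ▸ v0 ▸ ε) ∧ᵗ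
     call convergesᵗ (progRᵗ ▸ argᵗ ▸ v0 ▸ ε) ∧ᵗ call convergesᵗ (progRᵗ ▸ argᵗ′ ▸ v0 ▸ ε))
    (λ (s , _) → computed s) λ _ → refl
  inRangeᵗ = recast
    ((elLᵗ <ᵗ v0) ∧ᵗ (elLᵗ′ <ᵗ v0) ∧ᵗ (elRᵗ <ᵗ v0) ∧ᵗ (elRᵗ′ <ᵗ v0) ∧ᵗ notᵗ (sideLᵗ ≡ᵗ sideRᵗ))
    (λ (s , _) → inRange s) λ _ → refl

  labelOf : Tm (N ∷ []) N → Tm (N ∷ L Action ∷ []) Label
  labelOf t = call labelᵗ (v1 ▸ call t (v0 ▸ ε) ▸ ε)

  readyᵗ : Tm (N ∷ L Action ∷ []) B
  readyᵗ = recast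
    (call computedᵗ (v0 ▸ ε) ∧ᵗ call inRangeᵗ (v0 ▸ ε) ∧ᵗ notᵗ (call satisfiedᵗ (π₁′ v0 ▸ v1 ▸ ε)) ∧ᵗ
     call attackableᵗ (π₁′ v0 ▸ labelOf elLᵗ ▸ labelOf elLᵗ′ ▸ labelOf elRᵗ ▸ labelOf elRᵗ′ ▸ ε))
    (λ (s , h , _) → ready s h) λ _ → refl

  actionᵗ : Tm (N ∷ L Action ∷ []) Action
  actionᵗ = recast
    (v0 ,ᵗ π₁′ v0 ,ᵗ call sideLᵗ (v0 ▸ ε) ,ᵗ
     call attackᵗ (π₁′ v0 ▸ labelOf elLᵗ ▸ labelOf elLᵗ′ ▸ labelOf elRᵗ ▸ labelOf elRᵗ′ ▸ ε))
    (λ (s , h , _) → action s h) λ _ → refl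

open StageTerms using (readyᵗ; actionᵗ)

actionsᵗ : Tm (N ∷ []) (L Action)
actionsᵗ = recast (recᵗ []ᵗ (call readyᵗ (v0 ▸ v1 ▸ ε) ⇒ call actionᵗ (v0 ▸ v1 ▸ ε) ∷ᵗ v1 ∣ v1) v0)
  (λ (s , _) → actions s) λ _ → refl

labelAtᵗ : Tm (N ∷ N ∷ []) Label
labelAtᵗ = recast (call labelᵗ (call actionsᵗ (v0 ▸ ε) ▸ v1 ▸ ε)) (λ (s , n , _) → labelAt s n) λ _ → refl

-- What a single requirement achieves

halts-stable : ∀ s t st → s ≤ t → halted (steps s st) ≡ true → steps t st ≡ steps s st
halts-stable zero t st _ h = steps-halted t st h
halts-stable (suc s) (suc t) st (s≤s s≤t) h = halts-stable s t (step st) s≤t h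

program : ∀ {f} → Computable f → Tree
program (c , _) = ⌜ c ⌝

-- Compares the halted state with a stage known to be late enough. The equation for `e` is there
-- because stages obtain their programs by decoding.
value-correct : ∀ {f} (c : Computable f) e x s → e ≡ program c → converges e x s ≡ true → value e x s ≡ f x
value-correct {f} (c , ev) _ x s refl h with eval⇒halts (ev x)
... | s₀ , final = cong (λ st → hd N (proj₁ (proj₂ (proj₂ st))))
  (trans (sym (halts-stable s (s ⊔ s₀) (start ⌜ c ⌝ x) (m≤m⊔n s s₀) h)) (final (s ⊔ s₀) (m≤n⊔m s s₀)))

converges-eventually : ∀ {f} (c : Computable f) x → ∃[ s₀ ] (∀ e s → e ≡ program c → s₀ ≤ s → converges e x s ≡ true)
converges-eventually (c , ev) x with eval⇒halts (ev x)
... | s₀ , final = s₀ , λ { _ s refl le → cong halted (final s le) }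

-- If both sequences take free labels, at `x` and at `x′`, then unattackability at `x , x′` forces
-- `l′ x` to be free too. Unattackability at `x , y` then puts every `l y` in the column of `l x`.
unattackable-columns : ExcludedMiddle 0ℓ → ∀ k (l l′ : ℕ → ⟦ Label ⟧) →
  (∀ x y → attackable k (l x) (l y) (l′ x) (l′ y) ≢ true) →
  ∃[ n ] ((∀ x → col (l x) ≤ n) ⊎ (∀ x → col (l′ x) ≤ n))
unattackable-columns em k l l′ safe = go em em
  where
  fixed : ∀ (l : ℕ → ⟦ Label ⟧) → ¬ (∃[ x ] free k (l x) ≡ true) → ∀ x → col (l x) ≤ suc k
  fixed l none x with freeView k (l x)
  ... | isFree e _ = contradiction (x , e) none
  ... | isFixed _ le = le

  ∨-right : ∀ {p q} → q ≡ true → p ∨ q ≡ true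
  ∨-right {true} _ = refl
  ∨-right {false} h = h

  ∨-false : ∀ {p q} → p ∨ q ≢ true → p ≡ false × q ≡ false
  ∨-false {true} h = contradiction refl h
  ∨-false {false} {true} h = contradiction refl h
  ∨-false {false} {false} h = refl , refl

  same-columns : ∀ x y → free k (l x) ≡ true → free k (l′ x) ∨ free k (l′ y) ≡ true →
    differ (l x) (l y) ≡ false × differ (l′ x) (l′ y) ≡ false
  same-columns x y p q = ∨-false λ h → safe x y (cong₂ _∧_ p (cong₂ _∧_ q h))

  go : Dec (∃[ x ] free k (l x) ≡ true) → Dec (∃[ x ] free k (l′ x) ≡ true) →
    ∃[ n ] ((∀ x → col (l x) ≤ n) ⊎ (∀ x → col (l′ x) ≤ n))
  go (no none) _ = suc k , inj₁ (fixed l none)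
  go (yes _) (no none) = suc k , inj₂ (fixed l′ none)
  go (yes (x , p)) (yes (x′ , p′)) = col (l x) , inj₁ λ y →
    ≤-reflexive (sym (differ-false (l x) (l y) (proj₁ (same-columns x y p (cong (_∨ free k (l′ y)) free-x)))))
    where
    free-x : free k (l′ x) ≡ true
    free-x = trans (cong (suc k <ᵇ_) (differ-false (l′ x) (l′ x′)
      (proj₂ (same-columns x x′ p (∨-right {free k (l′ x)} p′))))) p′

module Requirement (em : ExcludedMiddle 0ℓ) {f g : ℕ → ℕ} (F : Computable f) (G : Computable g)
  {a b : ℕ} (a≢b : a ≢ b) where

  open Injury em

  number : ℕ
  number = pair (pair a (encTree (program F))) (pair b (encTree (program G)))

  lL lR : ℕ → ⟦ Label ⟧
  lL x = lim (pair a (f x))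
  lR x = lim (pair b (g x))

  private
    sideL≡ : ∀ {k} → k ≡ number → sideL k ≡ a
    sideL≡ refl = trans (cong π₁ (π₁-pair (pair a _) _)) (π₁-pair a _)

    sideR≡ : ∀ {k} → k ≡ number → sideR k ≡ b
    sideR≡ refl = trans (cong π₁ (π₂-pair (pair a (encTree (program F))) _)) (π₁-pair b _)

    progL≡ : ∀ {k} → k ≡ number → progL k ≡ program F
    progL≡ refl = trans (cong (λ n → decTree (π₂ n)) (π₁-pair (pair a _) _))
      (trans (cong decTree (π₂-pair a _)) (dec-encTree (program F)))

    progR≡ : ∀ {k} → k ≡ number → progR k ≡ program G
    progR≡ refl = trans (cong (λ n → decTree (π₂ n)) (π₂-pair (pair a (encTree (program F))) _))
      (trans (cong decTree (π₂-pair b _)) (dec-encTree (program G)))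

    module _ {s} (r≡ : req s ≡ number) where

      valueL : ∀ x → converges (progL (req s)) x s ≡ true → pair (sideL (req s)) (value (progL (req s)) x s) ≡ pair a (f x)
      valueL x h = cong₂ pair (sideL≡ r≡) (value-correct F (progL (req s)) x s (progL≡ r≡) h)

      valueR : ∀ x → converges (progR (req s)) x s ≡ true → pair (sideR (req s)) (value (progR (req s)) x s) ≡ pair b (g x)
      valueR x h = cong₂ pair (sideR≡ r≡) (value-correct G (progR (req s)) x s (progR≡ r≡) h)

    record Conj₄ (p q r s : Bool) : Set where
      constructor conj₄
      field
        h₁ : p ≡ true
        h₂ : q ≡ true
        h₃ : r ≡ true
        h₄ : s ≡ true

    conj₄-true : ∀ {p q r s : Bool} → p ∧ q ∧ r ∧ s ≡ true → Conj₄ p q r s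
    conj₄-true {true} {true} {true} h = conj₄ refl refl refl h

    conj₅-true : ∀ {p q r s t} → p ∧ q ∧ r ∧ s ∧ t ≡ true → Conj₄ p q r s × t ≡ true
    conj₅-true {true} {true} {true} {true} h = conj₄ refl refl refl refl , h

  acted-disagrees : ∀ {s} → Ready s → req s ≡ number → Quiet (suc (req s)) (suc s) →
    Disagree (lL (arg s)) (lL (arg′ s)) (lR (arg s)) (lR (arg′ s))
  acted-disagrees {s} r r≡ q = disagree-resp
    (onL (arg s) (h₁ cs) (h₁ bs)) (onL (arg′ s) (h₂ cs) (h₂ bs))
    (onR (arg s) (h₃ cs) (h₃ bs)) (onR (arg′ s) (h₄ cs) (h₄ bs))
    (attacks-disagree s (actions s) r)
    where
    open Conj₄
    cs : Conj₄ (converges (progL (req s)) (arg s) s) (converges (progL (req s)) (arg′ s) s)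
               (converges (progR (req s)) (arg s) s) (converges (progR (req s)) (arg′ s) s)
    cs = conj₄-true (ready-computed {s} {actions s} r)
    bs : Conj₄ (elL s <ᵇ s) (elL′ s <ᵇ s) (elR s <ᵇ s) (elR′ s <ᵇ s)
    bs = proj₁ (conj₅-true (ready-inRange {s} {actions s} r))
    onL : ∀ x → converges (progL (req s)) x s ≡ true →
      let n = pair (sideL (req s)) (value (progL (req s)) x s) in
      (n <ᵇ s) ≡ true → lL x ≡ relabelFree (req s) (proj₁ (attacks s (actions s))) (label (actions s) n)
    onL x c lt = trans (cong lim (sym (valueL {s} r≡ x c))) (trans (settled n r q (<ᵇ-true n s lt))
      (cong (λ m → relabelFree (req s) m (label (actions s) n)) (mapFor-own s n (π₁-pair (sideL (req s)) _))))
      where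
      n = pair (sideL (req s)) (value (progL (req s)) x s)
    onR : ∀ x → converges (progR (req s)) x s ≡ true →
      let n = pair (sideR (req s)) (value (progR (req s)) x s) in
      (n <ᵇ s) ≡ true → lR x ≡ relabelFree (req s) (proj₂ (attacks s (actions s))) (label (actions s) n)
    onR x c lt = trans (cong lim (sym (valueR {s} r≡ x c))) (trans (settled n r q (<ᵇ-true n s lt))
      (cong (λ m → relabelFree (req s) m (label (actions s) n)) (mapFor-other s n λ e →
        a≢b (trans (sym (sideL≡ r≡)) (trans (sym e) (trans (π₁-pair (sideR (req s)) _) (sideR≡ r≡)))))))
      where
      n = pair (sideR (req s)) (value (progR (req s)) x s)

  -- At such a stage the construction sees the true values and limit labels at the argument `z`.
  record Late (s z : ℕ) : Set where
    field
      cL : converges (progL (req s)) z s ≡ true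
      cR : converges (progR (req s)) z s ≡ true
      ltL : pair a (f z) < s
      ltR : pair b (g z) < s
      limL : labelAt s (pair a (f z)) ≡ lL z
      limR : labelAt s (pair b (g z)) ≡ lR z

  private
    attackable-resp : ∀ {k k′ l₁ l₁′ l₂ l₂′ m₁ m₁′ m₂ m₂′} → k ≡ k′ → l₁ ≡ m₁ → l₁′ ≡ m₁′ → l₂ ≡ m₂ → l₂′ ≡ m₂′ →
      attackable k′ m₁ m₁′ m₂ m₂′ ≡ true → attackable k l₁ l₁′ l₂ l₂′ ≡ true
    attackable-resp refl refl refl refl refl h = h

    label-resp : ∀ h {n n′ l} → n ≡ n′ → label h n′ ≡ l → label h n ≡ l
    label-resp h refl e = e

    <-resp : ∀ {n n′ s : ℕ} → n ≡ n′ → n′ < s → n < s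
    <-resp refl lt = lt

  attackable-ready : ∀ s → req s ≡ number → Late s (arg s) → Late s (arg′ s) →
    satisfied number (actions s) ≡ false →
    attackable number (lL (arg s)) (lL (arg′ s)) (lR (arg s)) (lR (arg′ s)) ≡ true → Ready s
  attackable-ready s r≡ X Y unsat att = ready-intro s (actions s)
    (computed-intro s (cL X) (cL Y) (cR X) (cR Y))
    (inRange-intro s (<-resp eL (ltL X)) (<-resp eL′ (ltL Y)) (<-resp eR (ltR X)) (<-resp eR′ (ltR Y))
      λ e → a≢b (trans (sym (sideL≡ r≡)) (trans e (sideR≡ r≡))))
    (trans (cong (λ k → satisfied k (actions s)) r≡) unsat)
    (attackable-resp r≡ (label-resp (actions s) eL (limL X)) (label-resp (actions s) eL′ (limL Y))
      (label-resp (actions s) eR (limR X)) (label-resp (actions s) eR′ (limR Y)) att)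
    where
    open Late
    eL : elL s ≡ pair a (f (arg s))
    eL = valueL {s} r≡ (arg s) (cL X)
    eL′ : elL′ s ≡ pair a (f (arg′ s))
    eL′ = valueL {s} r≡ (arg′ s) (cL Y)
    eR : elR s ≡ pair b (g (arg s))
    eR = valueR {s} r≡ (arg s) (cR X)
    eR′ : elR′ s ≡ pair b (g (arg′ s))
    eR′ = valueR {s} r≡ (arg′ s) (cR Y)

  late : ∀ z → ∃[ m ] (∀ s → req s ≡ number → m ≤ s → Late s z)
  late z = n₁ + (n₂ + (n₃ + (n₄ + (n₅ + n₆)))) , λ s r≡ le₁ →
    let le₂ = ≤-trans (m≤n+m _ n₁) le₁
        le₃ = ≤-trans (m≤n+m _ n₂) le₂
        le₄ = ≤-trans (m≤n+m _ n₃) le₃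
        le₅ = ≤-trans (m≤n+m _ n₄) le₄
    in record
      { cL = proj₂ (converges-eventually F z) (progL (req s)) s (progL≡ r≡) (≤-trans (m≤m+n n₃ _) le₃)
      ; cR = proj₂ (converges-eventually G z) (progR (req s)) s (progR≡ r≡) (≤-trans (m≤m+n n₄ _) le₄)
      ; ltL = ≤-trans (m≤m+n n₁ _) le₁
      ; ltR = ≤-trans (m≤m+n n₂ _) le₂
      ; limL = proj₂ (proj₂ (limit (pair a (f z)))) s (≤-trans (m≤m+n n₅ n₆) le₅)
      ; limR = proj₂ (proj₂ (limit (pair b (g z)))) s (≤-trans (m≤n+m n₆ n₅) le₅)
      }
    where
    n₁ n₂ n₃ n₄ n₅ n₆ : ℕ
    n₁ = suc (pair a (f z))
    n₂ = suc (pair b (g z))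
    n₃ = proj₁ (converges-eventually F z)
    n₄ = proj₁ (converges-eventually G z)
    n₅ = proj₁ (proj₂ (limit (pair a (f z))))
    n₆ = proj₁ (proj₂ (limit (pair b (g z))))

  stage-for : ∀ k x y m → ∃[ s ] (req s ≡ k × arg s ≡ x × arg′ s ≡ y × m ≤ s)
  -- The last component only makes the stage late, as a pair is at least as large as its components.
  stage-for k x y m = pair k (pair x (pair y m)) , π₁-pair k _ ,
    trans (cong π₁ (π₂-pair k _)) (π₁-pair x _) ,
    trans (cong (π₁ ∘ π₂) (π₂-pair k _)) (trans (cong π₁ (π₂-pair x _)) (π₁-pair y _)) ,
    ≤-trans (pair≥₂ y m) (≤-trans (pair≥₂ x _) (pair≥₂ k _))

  -- Attackable limit labels would be seen at some late stage for these arguments; the requirement,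
  -- being unsatisfied, would then act although it is silent.
  not-attackable : ∀ {s₀} → Quiet (suc number) s₀ → (∀ t → s₀ ≤ t → satisfied number (actions t) ≡ false) →
    ∀ x y → attackable number (lL x) (lL y) (lR x) (lR y) ≢ true
  not-attackable {s₀} q unsat x y att = at (stage-for number x y (s₀ + (proj₁ (late x) + proj₁ (late y))))
    where
    at : ∃[ s ] (req s ≡ number × arg s ≡ x × arg′ s ≡ y × s₀ + (proj₁ (late x) + proj₁ (late y)) ≤ s) → ⊥
    at (s , r≡ , x≡ , y≡ , le) = <⇒≢ (q s s₀≤s (attackable-ready s r≡
        (subst (Late s) (sym x≡) (proj₂ (late x) s r≡ (m+n≤o⇒m≤o (proj₁ (late x)) (m+n≤o⇒n≤o s₀ le))))
        (subst (Late s) (sym y≡) (proj₂ (late y) s r≡ (m+n≤o⇒n≤o (proj₁ (late x)) (m+n≤o⇒n≤o s₀ le))))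
        (unsat s s₀≤s)
        (subst₂ (λ x y → attackable number (lL x) (lL y) (lR x) (lR y) ≡ true) (sym x≡) (sym y≡) att))) (sym r≡)
      where
      s₀≤s : s₀ ≤ s
      s₀≤s = m+n≤o⇒m≤o s₀ le

  outcomes : (∃[ x ] ∃[ y ] Disagree (lL x) (lL y) (lR x) (lR y)) ⊎
    (∃[ n ] ((∀ x → col (lL x) ≤ n) ⊎ (∀ x → col (lR x) ≤ n)))
  outcomes = [ (λ (s , r , r≡ , q) → inj₁ (arg s , arg′ s , acted-disagrees r r≡ (subst (λ k → Quiet (suc k) (suc s)) (sym r≡) q)))
             , (λ (s , q , unsat) → inj₂ (unattackable-columns em number lL lR (not-attackable q unsat)))
             ]′ (outcome number)

-- The ceers

-- With the equation for the quotient below, this lets both be computed by counting up to `z`.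
suc-% : ∀ z n → suc z % suc n ≡ (if suc (z % suc n) ≡ᵇ suc n then 0 else suc (z % suc n))
suc-% z n with suc (z % suc n) ≟ suc n
... | yes e = trans (cong (_% suc n) (cong suc (m≡m%n+[m/n]*n z (suc n))))
  (trans ([m+kn]%n≡m%n (suc (z % suc n)) (z / suc n) (suc n))
  (trans (cong (_% suc n) e) (trans (n%n≡0 (suc n))
  (sym (if-true (trans (cong (_≡ᵇ suc n) e) (≡ᵇ-refl (suc n))))))))
... | no ne = trans (cong (_% suc n) (cong suc (m≡m%n+[m/n]*n z (suc n))))
  (trans ([m+kn]%n≡m%n (suc (z % suc n)) (z / suc n) (suc n))
  (trans (m<n⇒m%n≡m (≤∧≢⇒< (m%n<n z (suc n)) ne)) (sym (if-false (≢⇒≡ᵇ _ (suc n) ne)))))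

suc-/ : ∀ z n → suc z / suc n ≡ (if suc (z % suc n) ≡ᵇ suc n then suc (z / suc n) else z / suc n)
suc-/ z n = trans
  (trans (cong (_/ suc n) (cong suc (m≡m%n+[m/n]*n z (suc n))))
  (trans (+-distrib-/-∣ʳ (suc (z % suc n)) (n∣m*n (z / suc n))) (cong (suc (z % suc n) / suc n +_) (m*n/n≡m (z / suc n) (suc n)))))
  carry
  where
  carry : suc (z % suc n) / suc n + z / suc n ≡ (if suc (z % suc n) ≡ᵇ suc n then suc (z / suc n) else z / suc n)
  carry with suc (z % suc n) ≟ suc n
  ... | yes e = trans (cong (λ r → r / suc n + z / suc n) e) (trans (cong (_+ z / suc n) (n/n≡1 (suc n)))
    (sym (if-true (trans (cong (_≡ᵇ suc n) e) (≡ᵇ-refl (suc n))))))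
  ... | no ne = trans (cong (_+ z / suc n) (m<n⇒m/n≡0 (≤∧≢⇒< (m%n<n z (suc n)) ne))) (sym (if-false (≢⇒≡ᵇ _ (suc n) ne)))

modᵗ divᵗ : ℕ → Tm (N ∷ []) N
modᵗ n = recast (recᵗ (const 0) (sucᵗ v1 ≡ᵗ const (suc n) ⇒ const 0 ∣ sucᵗ v1) v0) (λ (z , _) → z % suc n) λ (z , _) → go z
  where
  next : ℕ → ℕ → ℕ
  next _ r = if suc r ≡ᵇ suc n then 0 else suc r
  go : ∀ z → natrec 0 next z ≡ z % suc n
  go zero = refl
  go (suc z) = trans (cong (next z) (go z)) (sym (suc-% z n))
divᵗ n = recast (recᵗ (const 0) (sucᵗ (call (modᵗ n) (v0 ▸ ε)) ≡ᵗ const (suc n) ⇒ sucᵗ v1 ∣ v1) v0)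
  (λ (z , _) → z / suc n) λ (z , _) → go z
  where
  next : ℕ → ℕ → ℕ
  next z q = if suc (z % suc n) ≡ᵇ suc n then suc q else q
  go : ∀ z → natrec 0 next z ≡ z / suc n
  go zero = refl
  go (suc z) = trans (cong (next z) (go z)) (sym (suc-/ z n))

-- The residue is subtracted first to match the form of `JoinLe`.
quotient : ℕ → ℕ → ℕ
quotient n z = (z ∸ z % suc n) / suc n

quotientᵗ : ℕ → Tm (N ∷ []) N
quotientᵗ n = recast (call (divᵗ n) (v0 ∸ᵗ call (modᵗ n) (v0 ▸ ε) ▸ ε)) (λ (z , _) → quotient n z) λ _ → refl

joinCode : ℕ → ⟦ Label ⟧ → ℕ
joinCode n (i , c) = i + c * suc n

joinCode-% : ∀ n l → col l ≤ n → joinCode n l % suc n ≡ col l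
joinCode-% n (i , c) le = trans ([m+kn]%n≡m%n i c (suc n)) (m<n⇒m%n≡m (s≤s le))

joinCode-/ : ∀ n l → (joinCode n l ∸ col l) / suc n ≡ proj₂ l
joinCode-/ n (i , c) = trans (cong (_/ suc n) (m+n∸m≡n i (c * suc n))) (m*n/n≡m c (suc n))

same⇔join : ∀ A n l l′ → col l ≤ n → col l′ ≤ n → Same A l l′ ⇔ JoinLe A n (joinCode n l) (joinCode n l′)
same⇔join A n l@(i , c) l′@(j , d) le le′ = mk⇔ to from
  where
  to : Same A l l′ → JoinLe A n (joinCode n l) (joinCode n l′)
  to (same refl h) = i , le , joinCode-% n l le , joinCode-% n l′ le′ ,
    subst₂ (A i) (sym (joinCode-/ n l)) (sym (joinCode-/ n l′)) h
  from : JoinLe A n (joinCode n l) (joinCode n l′) → Same A l l′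
  from (k , _ , e , e′ , h) with trans (sym e) (joinCode-% n l le) | trans (sym e′) (joinCode-% n l′ le′)
  ... | refl | refl = same refl (subst₂ (A k) (joinCode-/ n l) (joinCode-/ n l′) h)

joinLabel : ℕ → ℕ → ⟦ Label ⟧
joinLabel n z = z % suc n , quotient n z

join⇔same : ∀ A n z z′ → JoinLe A n z z′ ⇔ Same A (joinLabel n z) (joinLabel n z′)
join⇔same A n z z′ = mk⇔ to from
  where
  to : JoinLe A n z z′ → Same A (joinLabel n z) (joinLabel n z′)
  to (i , _ , refl , e , h) = same (sym e) (subst (λ j → A i (quotient n z) ((z′ ∸ j) / suc n)) (sym e) h)
  from : Same A (joinLabel n z) (joinLabel n z′) → JoinLe A n z z′
  from (same e h) = z % suc n , m<1+n⇒m≤n (m%n<n z (suc n)) , refl , sym e ,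
    subst (λ j → A (z % suc n) (quotient n z) ((z′ ∸ j) / suc n)) (sym e) h

val : ⟦ Label ⟧ → ℕ
val = proj₂

agree : PR 3 → ℕ → ⟦ Label ⟧ → ⟦ Label ⟧ → Bool
agree c s l l′ = (col l ≡ᵇ col l′) ∧ halted (steps s (⌜ c ⌝ , col l ∷ val l ∷ val l′ ∷ [] , [] , []))

agreeᵗ : PR 3 → Tm (N ∷ Label ∷ Label ∷ []) B
agreeᵗ c = recast
  ((fstᵗ v1 ≡ᵗ fstᵗ v2) ∧ᵗ call haltedᵗ (call stepsᵗ (v0 ▸ (const ⌜ c ⌝ ,ᵗ (fstᵗ v1 ∷ᵗ sndᵗ v1 ∷ᵗ sndᵗ v2 ∷ᵗ []ᵗ) ,ᵗ []ᵗ ,ᵗ []ᵗ) ▸ ε) ▸ ε))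
  (λ (s , l , l′ , _) → agree c s l l′) λ _ → refl

module _ (em : ExcludedMiddle 0ℓ) {A : ℕ → BinRel} (uce : UniformlyCE A) where

  open Soundness em

  agree-sound : ∀ s l l′ → agree (proj₁ uce) s l l′ ≡ true → Same A l l′
  agree-sound s (i , c) (j , d) h with ∧-true {i ≡ᵇ j} h
  ... | e , hl with ≡ᵇ-true i j e
  ... | refl = same refl (Equivalence.from (proj₂ uce i c d) (halts⇒eval (proj₁ uce) (i ∷ c ∷ d ∷ []) s hl))

  agree-complete : ∀ l l′ → Same A l l′ → ∃[ s₀ ] (∀ s → s₀ ≤ s → agree (proj₁ uce) s l l′ ≡ true)
  agree-complete (i , c) (.i , d) (same refl h) with Equivalence.to (proj₂ uce i c d) h
  ... | v , ev with eval⇒halts ev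
  ... | s₀ , final = s₀ , λ s le → cong₂ _∧_ (≡ᵇ-refl i) (cong halted (final s le))

module Ceers (em : ExcludedMiddle 0ℓ) (A : ℕ → BinRel) (ceer : ∀ i → IsCeer (A i)) (uce : UniformlyCE A) where

  open Injury em

  private
    module A i = IsEquivalence (proj₁ (ceer i))

  X : ℕ → BinRel
  X a x y = Same A (lim (pair a x)) (lim (pair a y))

  same-sym : ∀ {l l′} → Same A l l′ → Same A l′ l
  same-sym {i , _} {.i , _} (same refl h) = same refl (A.sym i h)

  same-trans : ∀ {l l′ l″} → Same A l l′ → Same A l′ l″ → Same A l l″
  same-trans {i , _} {.i , _} {.i , _} (same refl h) (same refl h′) = same refl (A.trans i h h′)

  X-equivalence : ∀ a → IsEquivalence (X a)
  X-equivalence a = record { refl = same refl (A.refl _) ; sym = same-sym ; trans = same-trans }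

  -- Both numbers must be below `s`, since only then do all later actions treat them alike.
  witnesses : ℕ → ℕ → ℕ → ℕ → Bool
  witnesses a s x y = (pair a x <ᵇ s) ∧ (pair a y <ᵇ s) ∧ agree (proj₁ uce) s (labelAt s (pair a x)) (labelAt s (pair a y))

  witnessesᵗ : ℕ → Tm (N ∷ N ∷ N ∷ []) B
  witnessesᵗ a = recast
    ((n <ᵗ v0) ∧ᵗ (n′ <ᵗ v0) ∧ᵗ call (agreeᵗ (proj₁ uce)) (v0 ▸ call labelAtᵗ (v0 ▸ n ▸ ε) ▸ call labelAtᵗ (v0 ▸ n′ ▸ ε) ▸ ε))
    (λ (s , x , y , _) → witnesses a s x y) λ _ → refl
    where
    n n′ : Tm (N ∷ N ∷ N ∷ []) N
    n = call pairN (const a ▸ v1 ▸ ε)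
    n′ = call pairN (const a ▸ v2 ▸ ε)

  witnesses-sound : ∀ a s x y → witnesses a s x y ≡ true → X a x y
  witnesses-sound a s x y h = same-persists (λ i → A.refl i) (trans (π₁-pair a x) (sym (π₁-pair a y)))
    (<ᵇ-true _ s (proj₁ h₁)) (<ᵇ-true _ s (proj₁ h₂)) (agree-sound em uce s _ _ (proj₂ h₂))
    where
    h₁ = ∧-true {pair a x <ᵇ s} h
    h₂ = ∧-true {pair a y <ᵇ s} (proj₂ h₁)

  witnesses-complete : ∀ a x y → X a x y → ∃[ s ] witnesses a s x y ≡ true
  witnesses-complete a x y h = s , cong₂ _∧_ (<⇒<ᵇ-true (m+n≤o⇒m≤o n₁ ≤-refl)) (cong₂ _∧_
      (<⇒<ᵇ-true (m+n≤o⇒m≤o n₂ le₂))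
      (subst₂ (λ l l′ → agree (proj₁ uce) s l l′ ≡ true)
        (sym (proj₂ (proj₂ (limit (pair a x))) s (m+n≤o⇒m≤o n₃ le₃)))
        (sym (proj₂ (proj₂ (limit (pair a y))) s (m+n≤o⇒m≤o n₄ le₄)))
        (proj₂ late s (m+n≤o⇒n≤o n₄ le₄))))
    where
    late = agree-complete em uce _ _ h
    n₁ = suc (pair a x)
    n₂ = suc (pair a y)
    n₃ = proj₁ (proj₂ (limit (pair a x)))
    n₄ = proj₁ (proj₂ (limit (pair a y)))
    s = n₁ + (n₂ + (n₃ + (n₄ + proj₁ late)))
    le₂ = m+n≤o⇒n≤o n₁ {n₂ + (n₃ + (n₄ + proj₁ late))} ≤-refl
    le₃ = m+n≤o⇒n≤o n₂ le₂
    le₄ = m+n≤o⇒n≤o n₃ le₃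

  X-ceer : ∀ a → IsCeer (X a)
  X-ceer a = X-equivalence a , ∃-ce (witnessesᵗ a) λ x y → mk⇔ (witnesses-complete a x y) λ (s , h) → witnesses-sound a s x y h

  -- The component `s` makes the number at least `s`, so it is born when only requirements above `n`
  -- still act, and these leave its column alone.
  lim-element : ∀ {n s} a l → Quiet (suc n) s → col l ≤ n → lim (pair a (pair (col l) (pair (val l) s))) ≡ l
  lim-element {n} {s} a (i , c) q le = trans
    (lim-birth (pair a (pair i (pair c s))) q
      (≤-trans (pair≥₂ c s) (≤-trans (pair≥₂ i _) (pair≥₂ a _)))
      (m≤n⇒m≤1+n (subst (_≤ n) (sym (cong proj₁ birth≡)) le)))
    birth≡
    where
    birth≡ : birth (pair a (pair i (pair c s))) ≡ (i , c)
    birth≡ = cong₂ _,_ (trans (cong π₁ (π₂-pair a _)) (π₁-pair i _))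
      (trans (cong (π₁ ∘ π₂) (π₂-pair a _)) (trans (cong π₁ (π₂-pair i _)) (π₁-pair c s)))

  join≤X : ∀ a n → JoinLe A n ≤ᶜ X a
  join≤X a n = f , toComputable fᵗ , λ x y → subst₂ (λ l l′ → JoinLe A n x y ⇔ Same A l l′)
      (sym (lim-f x)) (sym (lim-f y)) (join⇔same A n x y)
    where
    s = proj₁ (quiet (suc n))
    f : ℕ → ℕ
    f z = pair (z % suc n) (pair (quotient n z) s)
    fᵗ : Tm (N ∷ []) N
    fᵗ = recast (call pairN (call (modᵗ n) (v0 ▸ ε) ▸ call pairN (call (quotientᵗ n) (v0 ▸ ε) ▸ const s ▸ ε) ▸ ε))
      (λ (z , _) → f z) λ _ → refl
    lim-f : ∀ z → lim (pair a (f z)) ≡ joinLabel n z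
    lim-f z = lim-element a (joinLabel n z) (proj₂ (quiet (suc n))) (m<1+n⇒m≤n (m%n<n z (suc n)))

  -- Limit labels in columns up to `n` can be computed: after the stage `S`, where the requirements
  -- up to `n` are silent, the first label seen in such a column is final.
  low≤join : ∀ {Z : BinRel} {f} a n → Computable f → (∀ x y → Z x y ⇔ X a (f x) (f y)) →
    (∀ x → col (lim (pair a (f x))) ≤ n) → Z ≤ᶜ JoinLe A n
  low≤join {Z} {f} a n F red bnd = g , toComputable gᵗ , λ x y →
      subst₂ (λ u v → Z x y ⇔ JoinLe A n u v) (g≡ x) (g≡ y)
        (mk⇔ (Equivalence.to (eq x y) ∘ Equivalence.to (red x y)) (Equivalence.from (red x y) ∘ Equivalence.from (eq x y)))
    where
    S = proj₁ (quiet (suc n))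
    eq : ∀ x y → X a (f x) (f y) ⇔ JoinLe A n (joinCode n (lim (pair a (f x)))) (joinCode n (lim (pair a (f y))))
    eq x y = same⇔join A n _ _ (bnd x) (bnd y)
    nᵗ : ∀ {Γ} → Tm Γ N → Tm Γ N
    nᵗ t = call pairN (const a ▸ call (oracle F) (t ▸ ε) ▸ ε)
    settledAt : ℕ → ℕ → Bool
    settledAt s x = (S <ᵇ suc s) ∧ (col (labelAt s (pair a (f x))) <ᵇ suc n)
    settledᵗ : Tm (N ∷ N ∷ []) B
    settledᵗ = recast ((const S <ᵗ sucᵗ v0) ∧ᵗ (fstᵗ (call labelAtᵗ (v0 ▸ nᵗ v1 ▸ ε)) <ᵗ const (suc n)))
      (λ (s , x , _) → settledAt s x) λ _ → refl
    eventually : ∀ ρ → ∃[ s ] fun settledᵗ (s , ρ) ≡ true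
    eventually (x , _) = S ⊔ s₀ , cong₂ _∧_ (<⇒<ᵇ-true (s≤s (m≤m⊔n S s₀)))
        (<⇒<ᵇ-true (s≤s (subst (λ l → col l ≤ n) (sym (proj₂ (proj₂ (limit (pair a (f x)))) _ (m≤n⊔m S s₀))) (bnd x))))
      where
      s₀ = proj₁ (proj₂ (limit (pair a (f x))))
    codeᶠ : ℕ → ℕ → ℕ
    codeᶠ s x = joinCode n (labelAt s (pair a (f x)))
    codeᶠᵗ : Tm (N ∷ N ∷ []) N
    codeᶠᵗ = recast (fstᵗ lᵗ +ᵗ sndᵗ lᵗ *ᵗ const (suc n)) (λ (s , x , _) → codeᶠ s x) λ _ → refl
      where
      lᵗ : Tm (N ∷ N ∷ []) Label
      lᵗ = call labelAtᵗ (v0 ▸ nᵗ v1 ▸ ε)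
    stageFor : ℕ → ℕ
    stageFor x = search settledᵗ eventually (x , tt)
    g : ℕ → ℕ
    g x = codeᶠ (stageFor x) x
    gᵗ : Tm (N ∷ []) N
    gᵗ = recast (call codeᶠᵗ (searchᵗ settledᵗ eventually ▸ v0 ▸ ε)) (λ (x , _) → g x) λ _ → refl
    g≡ : ∀ x → joinCode n (lim (pair a (f x))) ≡ g x
    g≡ x = cong (joinCode n) (lim-at (pair a (f x))
        (quiet-later (m<1+n⇒m≤n (<ᵇ-true S _ (proj₁ h))) (proj₂ (quiet (suc n))))
        (m≤n⇒m≤1+n (m<1+n⇒m≤n (<ᵇ-true _ (suc n) (proj₂ h)))))
      where
      h = ∧-true {S <ᵇ suc (stageFor x)} (search-true settledᵗ eventually (x , tt))

  -- A disagreement is impossible: both reductions describe `Z`, but the merged pair is equivalent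
  -- and the separated one is not.
  exact : ∀ {a b} → a ≢ b → (Z : BinRel) → Z ≤ᶜ X a → Z ≤ᶜ X b → ∃[ n ] Z ≤ᶜ JoinLe A n
  exact {a} {b} a≢b Z (f , F , redF) (g , G , redG) = go outcomes
    where
    open Requirement em F G a≢b using (lL; lR; outcomes)
    go : (∃[ x ] ∃[ y ] Disagree (lL x) (lL y) (lR x) (lR y)) ⊎ (∃[ n ] ((∀ x → col (lL x) ≤ n) ⊎ (∀ x → col (lR x) ≤ n))) →
      ∃[ n ] Z ≤ᶜ JoinLe A n
    go (inj₁ (x , y , inj₁ (e , ne))) = contradiction
      (Same.col-same (Equivalence.to (redG x y) (Equivalence.from (redF x y) (subst (Same A (lL x)) e (same refl (A.refl _)))))) ne
    go (inj₁ (x , y , inj₂ (ne , e))) = contradiction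
      (Same.col-same (Equivalence.to (redF x y) (Equivalence.from (redG x y) (subst (Same A (lR x)) e (same refl (A.refl _)))))) ne
    go (inj₂ (n , inj₁ bnd)) = n , low≤join a n F redF bnd
    go (inj₂ (n , inj₂ bnd)) = n , low≤join b n G redG bnd

  exactPair : ∀ {a b} → a ≢ b → ExactPair A (X a) (X b)
  exactPair {a} {b} a≢b = X-ceer a , X-ceer b , join≤X a , join≤X b , λ Z _ → exact a≢b Z

-- Darkness

-- The arguments from 0 up to the number of classes are one too many; the bound on `y` is what
-- `join-separates` needs.
pigeonhole-classes : ∀ {R : BinRel} → IsEquivalence R → (fin : FinitelyManyClasses R) → (F : ℕ → ℕ) →
  ∃[ x ] ∃[ y ] x < y × y ≤ proj₁ fin × R (F x) (F y)
pigeonhole-classes {R} equiv (k , rep , cover) F with pigeonhole (n<1+n k) (λ i → proj₁ (cover (F (toℕ i))))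
... | i , j , i<j , e = toℕ i , toℕ j , i<j , m<1+n⇒m≤n (toℕ<n j) ,
  IsEquivalence.trans equiv (proj₂ (cover (F (toℕ i))))
    (IsEquivalence.sym equiv (subst (λ c → R (F (toℕ j)) (rep c)) (sym e) (proj₂ (cover (F (toℕ j))))))

increasing⇒< : ∀ {h : ℕ → ℕ} → (∀ x → h x < h (suc x)) → ∀ x y → x < y → h x < h y
increasing⇒< {h} inc x y = from-stage (λ y → h x < h y) (inc x) (λ t _ lt → <-trans lt (inc t)) y

increasing⇒injective : ∀ {h : ℕ → ℕ} → (∀ x → h x < h (suc x)) → ∀ {x y} → h x ≡ h y → x ≡ y
increasing⇒injective {h} inc {x} {y} e with <-cmp x y
... | tri≈ _ x≡y _ = x≡y
... | tri< x<y _ _ = contradiction e (<⇒≢ (increasing⇒< inc x y x<y))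
... | tri> _ _ y<x = contradiction (sym e) (<⇒≢ (increasing⇒< inc y x y<x))

module Darkness (em : ExcludedMiddle 0ℓ) (A : ℕ → BinRel) (ceer : ∀ i → IsCeer (A i)) where

  Infinite : (ℕ → ℕ) → ℕ → Set
  Infinite r i = ∀ m → ∃[ z ] m ≤ z × r z ≡ i

  -- Induction on `j`: the value `j` is either taken arbitrarily late or avoided from some point on.
  infinite-or-large : ∀ r j → (∃[ i ] Infinite r i) ⊎ (∃[ m ] (∀ z → m ≤ z → j ≤ r z))
  infinite-or-large r zero = inj₂ (0 , λ _ _ → z≤n)
  infinite-or-large r (suc j) with infinite-or-large r j
  ... | inj₁ inf = inj₁ inf
  ... | inj₂ (m , large) with em {∃[ m′ ] (∀ z → m′ ≤ z → r z ≢ j)}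
  ... | yes (m′ , avoid) = inj₂ (m ⊔ m′ , λ z le → ≤∧≢⇒<
          (large z (≤-trans (m≤m⊔n m m′) le)) (avoid z (≤-trans (m≤n⊔m m m′) le) ∘ sym))
  ... | no always = inj₁ (j , λ m′ → hit m′ em)
    where
    hit : ∀ m′ → Dec (∃[ z ] m′ ≤ z × r z ≡ j) → ∃[ z ] m′ ≤ z × r z ≡ j
    hit m′ (yes h) = h
    hit m′ (no none) = contradiction (m′ , λ z le e → none (z , le , e)) always

  infinite-residue : ∀ r n → (∀ z → r z ≤ n) → ∃[ i ] Infinite r i
  infinite-residue r n bnd with infinite-or-large r (suc n)
  ... | inj₁ inf = inf
  ... | inj₂ (m , large) = contradiction (bnd m) (<⇒≱ (large m ≤-refl))

  -- Infinitely many values of a reduction of Id to a join lie in a single summand,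
  -- and an increasing enumeration of their arguments reduces Id to that summand.
  id≤summand : ∀ n → IdRel ≤ᶜ JoinLe A n → ∃[ i ] IdRel ≤ᶜ A i
  id≤summand n (f , F , red) = i , g , toComputable gᵗ , λ x y → mk⇔ (λ { refl → IsEquivalence.refl (proj₁ (ceer i)) }) (back x y)
    where
    residue : ℕ → ℕ
    residue z = f z % suc n
    infinite = infinite-residue residue n λ z → m<1+n⇒m≤n (m%n<n (f z) (suc n))
    i : ℕ
    i = proj₁ infinite
    hitᵗ : Tm (N ∷ N ∷ []) B
    hitᵗ = recast ((v1 <ᵗ v0) ∧ᵗ (call (modᵗ n) (call (oracle F) (v0 ▸ ε) ▸ ε) ≡ᵗ const i))
      (λ (z , p , _) → (p <ᵇ z) ∧ (residue z ≡ᵇ i)) λ _ → refl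
    hits : ∀ ρ → ∃[ z ] fun hitᵗ (z , ρ) ≡ true
    hits (p , _) = proj₁ h , cong₂ _∧_ (<⇒<ᵇ-true (proj₁ (proj₂ h)))
        (trans (cong (_≡ᵇ i) (proj₂ (proj₂ h))) (≡ᵇ-refl i))
      where
      h = proj₂ infinite (suc p)
    next : ℕ → ℕ
    next p = search hitᵗ hits (p , tt)
    next-hits : ∀ p → p < next p × residue (next p) ≡ i
    next-hits p = <ᵇ-true p (next p) (proj₁ h) , ≡ᵇ-true _ i (proj₂ h)
      where
      h = ∧-true {p <ᵇ next p} (search-true hitᵗ hits (p , tt))
    h : ℕ → ℕ
    h k = next (natrec 0 (λ _ → next) k)
    hᵗ : Tm (N ∷ []) N
    hᵗ = recast (recᵗ (const 0) (call (searchᵗ hitᵗ hits) (v1 ▸ ε)) (sucᵗ v0)) (λ (k , _) → h k) λ _ → refl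
    h-increasing : ∀ k → h k < h (suc k)
    h-increasing k = proj₁ (next-hits (h k))
    h-residue : ∀ k → residue (h k) ≡ i
    h-residue k = proj₂ (next-hits (natrec 0 (λ _ → next) k))
    g : ℕ → ℕ
    g k = quotient n (f (h k))
    gᵗ : Tm (N ∷ []) N
    gᵗ = recast (call (quotientᵗ n) (call (oracle F) (hᵗ ▸ ε) ▸ ε)) (λ (k , _) → g k) λ _ → refl
    back : ∀ x y → A i (g x) (g y) → x ≡ y
    -- All chosen values have residue `i`, so a relation between quotients lifts to the join, where
    -- the reduction of `IdRel` reflects it.
    back x y r = increasing⇒injective {h} h-increasing (Equivalence.from (red (h x) (h y))
      (Equivalence.from (join⇔same A n (f (h x)) (f (h y)))
        (same (trans (h-residue x) (sym (h-residue y))) (subst (λ j → A j (g x) (g y)) (sym (h-residue x)) r))))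

  id≰join : (∀ i → Dark (A i) ⊎ FinitelyManyClasses (A i)) → ∀ n → ¬ (IdRel ≤ᶜ JoinLe A n)
  id≰join dark n red = absurd (id≤summand n red)
    where
    absurd : ¬ (∃[ i ] IdRel ≤ᶜ A i)
    absurd (i , red′@(f , _ , iff)) with dark i
    ... | inj₁ (_ , id≰) = id≰ red′
    ... | inj₂ fin with pigeonhole-classes (proj₁ (ceer i)) fin f
    ... | x , y , x<y , _ , r = <⇒≢ x<y (Equivalence.from (iff x y) r)

-- The numbers up to `n` are their own residues, so they lie in different summands.
join-separates : ∀ A {n x y} → x < y → y ≤ n → ¬ JoinLe A n x y
join-separates A x<y y≤n (i , _ , ex , ey , _) = <⇒≢ x<y
  (trans (sym (m<n⇒m%n≡m (s≤s (≤-trans (<⇒≤ x<y) y≤n)))) (trans ex (trans (sym ey) (m<n⇒m%n≡m (s≤s y≤n)))))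

module _ (em : ExcludedMiddle 0ℓ) (A : ℕ → BinRel) (ceer : ∀ i → IsCeer (A i)) (uce : UniformlyCE A) where

  open Ceers em A ceer uce
  open Darkness em A ceer

  -- With `k` classes in `X a`, the join up to `k` could not embed its `k + 1` inequivalent
  -- elements.
  infinitely-many-classes : ∀ a → ¬ FinitelyManyClasses (X a)
  infinitely-many-classes a fin@(k , _) = absurd (join≤X a k)
    where
    absurd : JoinLe A k ≤ᶜ X a → ⊥
    absurd (f , _ , red) =
      let x , y , x<y , y≤k , r = pigeonhole-classes (X-equivalence a) fin f
      in join-separates A x<y y≤k (Equivalence.from (red x y) r)

  dark-pair : (∀ i → Dark (A i) ⊎ FinitelyManyClasses (A i)) → ∃[ a ] ∃[ b ] a ≢ b × Dark (X a) × Dark (X b)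
  dark-pair dark = go em em
    where
    not-both : ∀ {a b} → a ≢ b → IdRel ≤ᶜ X a → ¬ (IdRel ≤ᶜ X b)
    not-both a≢b ra rb = (λ (n , r) → id≰join dark n r) (exact a≢b IdRel ra rb)
    isDark : ∀ a → ¬ (IdRel ≤ᶜ X a) → Dark (X a)
    isDark a id≰ = infinitely-many-classes a , id≰
    go : Dec (IdRel ≤ᶜ X 0) → Dec (IdRel ≤ᶜ X 1) → ∃[ a ] ∃[ b ] a ≢ b × Dark (X a) × Dark (X b)
    -- `IdRel` reduces to at most one side, so one positive answer makes the other two sides dark.
    go (yes r) _ = 1 , 2 , (λ ()) , isDark 1 (not-both (λ ()) r) , isDark 2 (not-both (λ ()) r)
    go (no r₀) (yes r) = 0 , 2 , (λ ()) , isDark 0 r₀ , isDark 2 (not-both (λ ()) r)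
    go (no r₀) (no r₁) = 0 , 1 , (λ ()) , isDark 0 r₀ , isDark 1 r₁

theorem7p2 : ExcludedMiddle 0ℓ →
    (A : ℕ → BinRel) → (∀ i → IsCeer (A i)) → UniformlyCE A →
    Σ BinRel (λ X → Σ BinRel (λ Y → ExactPair A X Y))
    × ((∀ i → Dark (A i) ⊎ FinitelyManyClasses (A i)) →
    Σ BinRel (λ X → Σ BinRel (λ Y → ExactPair A X Y × Dark X × Dark Y)))
theorem7p2 em A ceer uce = (X 0 , X 1 , exactPair λ ()) , λ dark →
  let a , b , a≢b , darkX , darkY = dark-pair em A ceer uce dark
  in X a , X b , exactPair a≢b , darkX , darkY
  where
  open Ceers em A ceer uce
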